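{- Let $\tau$ be a relational vocabulary containing $<,+,\times$, let $X$ be an $r$-ary second-order variable and let $\varphi(X)$ be a first-order $\tau$-formula (which may contain atomic formulas $Xx_1\dots x_r$) without free first-order variables, in which $X$ does not occur in the scope of an existential quantifier or of a negation symbol. Then the parameterized problem $\mathrm{FD}_{\varphi(X)}$ Fagin-defined by $\varphi(X)$ is slicewise definable in $\mathrm{FO}_q$ for some $q\in\mathbb N$.
   Context: For $n\in\mathbb N$ let $[n]=\{0,\dots,n-1\}$ with natural order and $+^{[n]}=\{(a,b,c)\in[n]^3:c=a+b\}$, $\times^{[n]}=\{(a,b,c)\in[n]^3:c=ab\}$. A finite $\tau$-structure has built-in addition and multiplication if its $\{<,+,\times\}$-reduct is isomorphic to $([n],<^{[n]},+^{[n]},\times^{[n]})$; $\mathrm{ARITHM}[\tau]$ is the class of these. $C(m)=\{\overline\ell:\ell<m\}$ are new constants, and $\mathbf A_{C(m)}$ interprets $\overline\ell$ as the element corresponding to $\ell$ if $\ell<|A|$, else to $|A|-1$. $\mathrm{FO}_q$ is the set of first-order sentences of quantifier rank at most $q$. A parameterized problem $Q\subseteq\mathrm{ARITHM}[\tau]\times\mathbb N$ (slices closed under isomorphism) is slicewise definable in $\mathrm{FO}_q$ if there are computable $h$ and $f$ with $f(k)$ an $\mathrm{FO}_q[\tau\cup C(h(k))]$-sentence such that $(\mathbf A,k)\in Q\iff\mathbf A_{C(h(k))}\models f(k)$ for all $(\mathbf A,k)$. The problem $\mathrm{FD}_{\varphi(X)}$ Fagin-defined by $\varphi(X)$ consists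 of the pairs $(\mathbf A,k)\in\mathrm{ARITHM}[\tau]\times\mathbb N$ such that there is $S\subseteq A^r$ with $|S|=k$ and $\mathbf A\models\varphi(S)$. -}

module Defs where

open import Data.Nat using (ℕ; zero; suc; _<_; _+_; _*_; _⊔_)
open import Data.Fin using (Fin; zero; suc; toℕ)
open import Data.Vec using (Vec; []; _∷_; lookup; map)
open import Data.List using (List; []; _∷_; length)
import Data.List as L
open import Data.Bool using (Bool; T)
open import Data.Product using (Σ; _×_; _,_; ∃)
open import Data.Sum using (_⊎_)
open import Data.Unit using (⊤)
open import Data.Empty using (⊥)
open import Relation.Nullary using (¬_)
open import Relation.Binary.PropositionalEquality using (_≡_)
open import Function.Bundles using (_⇔_)
open import Function.Definitions using (Bijective)
open import Data.List.Relation.Unary.Unique.Propositional using (Unique)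
open import Data.List.Membership.Propositional using (_∈_)

record Vocab : Set where
  field
    nExtra     : ℕ
    arityExtra : Fin nExtra → ℕ

open Vocab public

data Sym (τ : Vocab) : Set where
  lt plus times : Sym τ
  ext : Fin (nExtra τ) → Sym τ

arity : {τ : Vocab} → Sym τ → ℕ
arity lt = 2
arity plus = 3
arity times = 3
arity {τ} (ext i) = arityExtra τ i

-- Syntax.  Formula τ V m n : first-order formulas over τ ∪ C(m),
-- with second-order variables of arities listed in V, and n free
-- first-order variables (de Bruijn).

data Term (m n : ℕ) : Set where
  var   : Fin n → Term m n
  const : Fin m → Term m n

data Formula (τ : Vocab) (V : List ℕ) (m : ℕ) : ℕ → Set where
  rel   : ∀ {n} (R : Sym τ) → Vec (Term m n) (arity R) → Formula τ V m n
  eq    : ∀ {n} → Term m n → Term m n → Formula τ V m n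
  sov   : ∀ {n} (i : Fin (length V)) → Vec (Term m n) (L.lookup V i) → Formula τ V m n
  neg   : ∀ {n} → Formula τ V m n → Formula τ V m n
  conj  : ∀ {n} → Formula τ V m n → Formula τ V m n → Formula τ V m n
  disj  : ∀ {n} → Formula τ V m n → Formula τ V m n → Formula τ V m n
  exi   : ∀ {n} → Formula τ V m (suc n) → Formula τ V m n
  all   : ∀ {n} → Formula τ V m (suc n) → Formula τ V m n

Sentence : Vocab → ℕ → Set
Sentence τ m = Formula τ [] m 0

qr : ∀ {τ V m n} → Formula τ V m n → ℕ
qr (rel R ts) = 0
qr (eq s t) = 0
qr (sov i ts) = 0
qr (neg φ) = qr φ
qr (conj φ ψ) = qr φ ⊔ qr ψ
qr (disj φ ψ) = qr φ ⊔ qr ψ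
qr (exi φ) = suc (qr φ)
qr (all φ) = suc (qr φ)

NoSO : ∀ {τ V m n} → Formula τ V m n → Set
NoSO (rel R ts) = ⊤
NoSO (eq s t) = ⊤
NoSO (sov i ts) = ⊥
NoSO (neg φ) = NoSO φ
NoSO (conj φ ψ) = NoSO φ × NoSO ψ
NoSO (disj φ ψ) = NoSO φ × NoSO ψ
NoSO (exi φ) = NoSO φ
NoSO (all φ) = NoSO φ

SONotUnderExNeg : ∀ {τ V m n} → Formula τ V m n → Set
SONotUnderExNeg (rel R ts) = ⊤
SONotUnderExNeg (eq s t) = ⊤
SONotUnderExNeg (sov i ts) = ⊤
SONotUnderExNeg (neg φ) = NoSO φ
SONotUnderExNeg (conj φ ψ) = SONotUnderExNeg φ × SONotUnderExNeg ψ
SONotUnderExNeg (disj φ ψ) = SONotUnderExNeg φ × SONotUnderExNeg ψ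
SONotUnderExNeg (exi φ) = NoSO φ
SONotUnderExNeg (all φ) = SONotUnderExNeg φ

record Structure (τ : Vocab) : Set₁ where
  field
    Carrier : Set
    relI    : (R : Sym τ) → Vec Carrier (arity R) → Bool

open Structure public

evalT : ∀ {m n} {A : Set} → (Fin m → A) → Vec A n → Term m n → A
evalT c env (var i) = lookup env i
evalT c env (const j) = c j

Sat : ∀ {τ V m n} (A : Structure τ) → (Fin m → Carrier A) →
      ((i : Fin (length V)) → Vec (Carrier A) (L.lookup V i) → Set) →
      Vec (Carrier A) n → Formula τ V m n → Set
Sat A c X env (rel R ts) = T (relI A R (map (evalT c env) ts))
Sat A c X env (eq s t) = evalT c env s ≡ evalT c env t
Sat A c X env (sov i ts) = X i (map (evalT c env) ts)
Sat A c X env (neg φ) = ¬ Sat A c X env φ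
Sat A c X env (conj φ ψ) = Sat A c X env φ × Sat A c X env ψ
Sat A c X env (disj φ ψ) = Sat A c X env φ ⊎ Sat A c X env ψ
Sat A c X env (exi φ) = Σ (Carrier A) λ a → Sat A c X (a ∷ env) φ
Sat A c X env (all φ) = (a : Carrier A) → Sat A c X (a ∷ env) φ

-- Built-in addition and multiplication.  A witness is an isomorphism
-- ι from ([N+1], <, +, ×) onto the {<,+,×}-reduct of A.

record ArithIso {τ : Vocab} (A : Structure τ) : Set where
  field
    N     : ℕ
    ι     : Fin (suc N) → Carrier A
    ι-bij : Bijective _≡_ _≡_ ι
    ι-lt  : ∀ a b → T (relI A lt (ι a ∷ ι b ∷ [])) ⇔ (toℕ a < toℕ b)
    ι-add : ∀ a b c → T (relI A plus (ι a ∷ ι b ∷ ι c ∷ [])) ⇔ (toℕ c ≡ toℕ a + toℕ b)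
    ι-mul : ∀ a b c → T (relI A times (ι a ∷ ι b ∷ ι c ∷ [])) ⇔ (toℕ c ≡ toℕ a * toℕ b)

clamp : ℕ → (N : ℕ) → Fin (suc N)
clamp zero N = zero
clamp (suc ℓ) zero = zero
clamp (suc ℓ) (suc N) = suc (clamp ℓ N)

constsC : ∀ {τ} {A : Structure τ} → ArithIso A → (m : ℕ) → Fin m → Carrier A
constsC w m ℓ = ArithIso.ι w (clamp (toℕ ℓ) (ArithIso.N w))

-- Fagin-defined problem: (A,k) ∈ FD_φ iff there is S ⊆ A^r, |S| = k,
-- with A ⊨ φ(S).  S is given as a duplicate-free list of r-tuples.

FD : ∀ {τ r} → Formula τ (r ∷ []) 0 0 → (A : Structure τ) → ℕ → Set
FD {τ} {r} φ A k =
  Σ (List (Vec (Carrier A) r)) λ S →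
    Unique S × length S ≡ k ×
    Sat A (λ ()) (λ { zero t → t ∈ S }) [] φ

SlicewiseFO : (τ : Vocab) → ℕ →
  ((A : Structure τ) → ArithIso A → ℕ → Set) → Set₁
SlicewiseFO τ q Q =
  Σ (ℕ → ℕ) λ h →
  Σ ((k : ℕ) → Sentence τ (h k)) λ f →
    ((k : ℕ) → qr (f k) Data.Nat.≤ q) ×
    ((A : Structure τ) (w : ArithIso A) (k : ℕ) →
       Q A w k ⇔ Sat A (constsC w (h k)) (λ ()) [] (f k))

{-# OPTIONS --safe #-}
module Submission where

-- Since X occurs only positively and outside existential quantifiers, whenever φ(S) fails
-- there are at most d tuples outside S (d depending on φ only) one of which belongs to
-- every solution. Branching on them k times either finds a solution of size ≤ k or yields a
-- set W of boundedly many tuples such that, for every map h on A that is injective on the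
-- entries of W, no set U of k tuples of h-values satisfies φ(X) with X t read as h(t) ∈ U.
-- Conversely a solution S yields U = h(S) for every h. Hence φ has a solution of size ≤ k
-- iff for every h in a family that is injective on each small set for a suitable member,
-- some k-set U of h-values satisfies φ; if h has boundedly many values, U ranges over a
-- finite disjunction, and only the parameters of h must be quantified.
--
-- Such a family is x ↦ z mod (1 + ((x mod p) + 1) u), with p, u, z < |A|: a small p not
-- dividing the product of the differences of the given elements keeps them distinct, and
-- by the Chinese remainder theorem (Gödel's β function) some z gives their residues the
-- values 0, 1, 2, ... In structures too small for this, constants name all elements.
--
-- As φ is monotone in X, "size k" means "size ≤ k" together with |A|^r ≥ k, and the latter
-- says that some h takes k distinct values on tuples.

open import Defs
open import Data.Bool using (Bool; true; false; T; T?; if_then_else_)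
import Data.Bool.Properties as Bool
open import Data.Empty using (⊥-elim)
open import Data.Fin using (#_)
open import Data.Fin.Base using (Fin; zero; suc; toℕ; fromℕ<; punchOut; _↑ˡ_; _↑ʳ_)
import Data.Fin.Properties as Fin
open import Data.List as List using (List; []; _∷_; length; map; _++_; filter; concatMap; cartesianProductWith; upTo; allFin; deduplicate)
open import Data.List.Membership.Propositional using (_∈_; _∉_; find; lose)
open import Data.List.Membership.Propositional.Properties
open import Data.List.Properties using (length-++; length-map; length-upTo; length-deduplicate; ++-identityʳ)
open import Data.List.Relation.Binary.Subset.Propositional using (_⊆_)
open import Data.List.Relation.Unary.All as All using (All; []; _∷_; all?)
import Data.List.Relation.Unary.All.Properties as All
open import Data.List.Relation.Unary.AllPairs using (AllPairs; []; _∷_)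
import Data.List.Relation.Unary.AllPairs.Properties as AllPairs
open import Data.List.Relation.Unary.Any as Any using (Any; here; there)
import Data.List.Relation.Unary.Any.Properties as Any
import Data.List.Relation.Unary.Unique.DecPropositional as UniqueDec
import Data.List.Relation.Unary.Unique.DecPropositional.Properties as UniqueDecP
open import Data.List.Relation.Unary.Unique.Propositional using (Unique)
import Data.List.Relation.Unary.Unique.Propositional.Properties as Unique
open import Data.Nat
open import Data.Nat.Coprimality using (Coprime; coprime-divisor)
import Data.Nat.Coprimality as Coprime
open import Data.Nat.Divisibility
open import Data.Nat.DivMod using (m≡m%n+[m/n]*n; m%n<n; m<n⇒m%n≡m; m/n≤m; [m+kn]%n≡m%n; %-remove-+ʳ)
open import Data.Nat.ListAction using (product)
open import Data.Nat.ListAction.Properties using (∈⇒∣product; product≢0)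
open import Data.Nat.Properties
open import Data.Nat.Tactic.RingSolver using (solve-∀)
open import Data.Product as Product using (∃; Σ; _×_; _,_; proj₁; proj₂)
open import Data.Sum as Sum using (_⊎_; inj₁; inj₂)
open import Data.Vec as Vec using (Vec; []; _∷_)
import Data.Vec.Properties as Vec
open import Function using (_∘_; _on_; _⇔_; mk⇔; Equivalence)
open import Function.Definitions using (Injective)
open import Relation.Binary.Definitions using (DecidableEquality)
open import Relation.Binary.PropositionalEquality
open import Relation.Nullary using (¬_; Dec; yes; no; does; ¬?; contradiction)
open import Relation.Nullary.Decidable using (True; map′; _×-dec_; _⊎-dec_; decidable-stable)

open Equivalence using (to; from)

-- Separating finitely many numbers by remainders

-- The lower bound 1 keeps the factors of equal entries nonzero, so `spread` is a positive common
-- multiple of all nonzero differences.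
dist⁺ : ℕ → ℕ → ℕ
dist⁺ x y = 1 ⊔ ∣ x - y ∣

spread : List ℕ → ℕ
spread xs = product (cartesianProductWith dist⁺ xs xs)

-- The moduli of Gödel's β function. They serve twice: as candidates for the first modulus `suc p`,
-- and as the moduli of the second reduction.
betaModulus : ℕ → ℕ → ℕ
betaModulus u y = suc (suc y * u)

∣x-y∣∣spread : ∀ {xs x y} → x ∈ xs → y ∈ xs → x ≢ y → ∣ x - y ∣ ∣ spread xs
∣x-y∣∣spread {xs} {x} {y} x∈ y∈ x≢y =
  subst (_∣ spread xs) (m≤n⇒m⊔n≡n (n≢0⇒n>0 (x≢y ∘ ∣m-n∣≡0⇒m≡n)))
    (∈⇒∣product (∈-cartesianProductWith⁺ dist⁺ x∈ y∈))

spread>0 : ∀ xs → 0 < spread xs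
spread>0 xs = >-nonZero⁻¹ _ {{product≢0 (All.tabulate λ d∈ → nz d∈)}}
  where
  nz : ∀ {d} → d ∈ cartesianProductWith dist⁺ xs xs → NonZero d
  nz d∈ with ∈-cartesianProductWith⁻ dist⁺ xs xs d∈
  ... | x , y , _ , _ , refl = >-nonZero (m≤m⊔n 1 ∣ x - y ∣)

product-≤ : ∀ {b} xs l → 0 < b → All (_≤ b) xs → length xs ≤ l → product xs ≤ b ^ l
product-≤ {b} [] l b>0 [] _ = m^n>0 b {{>-nonZero b>0}} l
product-≤ (x ∷ xs) (suc l) b>0 (x≤b ∷ xs≤b) (s≤s len) = *-mono-≤ x≤b (product-≤ xs l b>0 xs≤b len)

length-cartesianProductWith : ∀ {A B C : Set} (f : A → B → C) xs ys →
  length (cartesianProductWith f xs ys) ≡ length xs * length ys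
length-cartesianProductWith f [] ys = refl
length-cartesianProductWith f (x ∷ xs) ys = trans (length-++ (map (f x) ys))
  (cong₂ _+_ (length-map (f x) ys) (length-cartesianProductWith f xs ys))

spread-≤ : ∀ {b g} xs → 0 < b → All (_< b) xs → length xs ≤ g → spread xs ≤ b ^ (g * g)
spread-≤ {b} {g} xs b>0 xs<b len = product-≤ _ (g * g) b>0 (All.tabulate le)
  (≤-trans (≤-reflexive (length-cartesianProductWith dist⁺ xs xs)) (*-mono-≤ len len))
  where
  le : ∀ {d} → d ∈ cartesianProductWith dist⁺ xs xs → d ≤ b
  le d∈ with ∈-cartesianProductWith⁻ dist⁺ xs xs d∈
  ... | x , y , x∈ , y∈ , refl = ⊔-lub b>0 (≤-trans (∣m-n∣≤m⊔n x y)
    (⊔-lub (<⇒≤ (All.lookup xs<b x∈)) (<⇒≤ (All.lookup xs<b y∈))))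

%-≡⇒∣∣-∣ : ∀ {x y} p .{{_ : NonZero p}} → x % p ≡ y % p → p ∣ ∣ x - y ∣
%-≡⇒∣∣-∣ {x} {y} p eqn = divides ∣ x / p - y / p ∣ (begin
  ∣ x - y ∣                                     ≡⟨ cong₂ ∣_-_∣ (m≡m%n+[m/n]*n x p) (m≡m%n+[m/n]*n y p) ⟩
  ∣ x % p + x / p * p - y % p + y / p * p ∣     ≡⟨ cong (λ r → ∣ x % p + x / p * p - r + y / p * p ∣) eqn ⟨
  ∣ x % p + x / p * p - x % p + y / p * p ∣     ≡⟨ ∣m+n-m+o∣≡∣n-o∣ (x % p) _ _ ⟩
  ∣ x / p * p - y / p * p ∣                     ≡⟨ *-distribʳ-∣-∣ p (x / p) (y / p) ⟨
  ∣ x / p - y / p ∣ * p                         ∎)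
  where open ≡-Reasoning

-- A common divisor of 1 + a and of a * a divides a * (1 + a) - a * a = a.
∣suc∣sq⇒≡1 : ∀ {d} a → d ∣ suc a → d ∣ a * a → d ≡ 1
∣suc∣sq⇒≡1 {d} a d∣suc d∣sq = ∣1⇒≡1 (∣m+n∣m⇒∣n (subst (d ∣_) (+-comm 1 a) d∣suc) d∣a)
  where
  d∣a : d ∣ a
  d∣a = ∣m+n∣m⇒∣n (subst (d ∣_) (trans (*-suc a a) (+-comm a (a * a))) (∣n⇒∣m*n a d∣suc)) d∣sq

-- A common divisor divides the difference `∣ x - y ∣ * u` of the moduli, hence `u * u`, hence the
-- square of `suc x * u`. Being also a divisor of `suc (suc x * u)`, it is 1.
betaModulus-coprime : ∀ {u x y} → ∣ x - y ∣ ∣ u → Coprime (betaModulus u x) (betaModulus u y)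
betaModulus-coprime {u} {x} {y} diff∣u {d} (d∣x , d∣y) = ∣suc∣sq⇒≡1 (suc x * u) d∣x
  (subst (d ∣_) (solve-sq (suc x) u) (∣n⇒∣m*n (suc x * suc x) (∣-trans d∣diff (*-monoˡ-∣ u diff∣u))))
  where
  solve-sq : ∀ s u → s * s * (u * u) ≡ s * u * (s * u)
  solve-sq = solve-∀
  d∣∣-∣ : ∀ {a b} → d ∣ a → d ∣ b → d ∣ ∣ a - b ∣
  d∣∣-∣ (divides-refl a) (divides-refl b) = divides ∣ a - b ∣ (sym (*-distribʳ-∣-∣ d a b))
  d∣diff : d ∣ ∣ x - y ∣ * u
  d∣diff = subst (d ∣_) (sym (*-distribʳ-∣-∣ u (suc x) (suc y))) (d∣∣-∣ d∣x d∣y)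

AllPairs-tabulate : ∀ {A : Set} {R : A → A → Set} {xs} → Unique xs →
  (∀ {x y} → x ∈ xs → y ∈ xs → x ≢ y → R x y) → AllPairs R xs
AllPairs-tabulate [] r = []
AllPairs-tabulate (x∉ ∷ xs!) r =
  All.tabulate (λ y∈ → r (here refl) (there y∈) (All.lookup x∉ y∈)) ∷
  AllPairs-tabulate xs! (λ x∈ y∈ → r (there x∈) (there y∈))

betaModuli-coprime : ∀ {u xs} → Unique xs → spread xs ∣ u →
  AllPairs (Coprime on betaModulus u) xs
betaModuli-coprime {u} xs! s∣u = AllPairs-tabulate xs! λ {x} {y} x∈ y∈ x≢y →
  betaModulus-coprime {u} {x} {y} (∣-trans (∣x-y∣∣spread x∈ y∈ x≢y) s∣u)

-- The Chinese remainder theorem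

coprime-* : ∀ {m n o} → Coprime m n → Coprime m o → Coprime m (n * o)
coprime-* m⊥n m⊥o (d∣m , d∣no) =
  m⊥o (d∣m , coprime-divisor (λ (e∣d , e∣n) → m⊥n (∣-trans e∣d d∣m , e∣n)) d∣no)

coprime-product : ∀ {A : Set} (f : A → ℕ) {m xs} → All (Coprime m ∘ f) xs → Coprime m (product (map f xs))
coprime-product f [] = ∣1⇒≡1 ∘ proj₂
coprime-product f (m⊥x ∷ m⊥xs) = coprime-* m⊥x (coprime-product f m⊥xs)

product-∣ : ∀ {A : Set} (f : A → ℕ) {xs n} → AllPairs (Coprime on f) xs →
  (∀ {x} → x ∈ xs → f x ∣ n) → product (map f xs) ∣ n
product-∣ f [] _ = 1∣ _
product-∣ f {x ∷ xs} {n} (x⊥ ∷ xs⊥) div with div (here refl) | product-∣ f xs⊥ (div ∘ there)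
... | divides-refl q | Π∣qx = subst (_∣ q * f x) (*-comm _ (f x))
  (*-monoˡ-∣ (f x) (coprime-divisor (Coprime.sym (coprime-product f x⊥))
    (subst (product (map f xs) ∣_) (*-comm q (f x)) Π∣qx)))

-- Punching out a missed value would leave an injection into a smaller `Fin`.
Fin-injective⇒surjective : ∀ {n} (f : Fin n → Fin n) → Injective _≡_ _≡_ f → ∀ c → ∃ λ s → f s ≡ c
Fin-injective⇒surjective {suc n} f inj c with Fin.any? (λ s → f s Fin.≟ c)
... | yes found = found
... | no missed = contradiction
  (Fin.injective⇒≤ {f = λ s → punchOut {i = c} {j = f s} (λ eqn → missed (s , sym eqn))}
    (λ eqn → inj (Fin.punchOut-injective {i = c} _ _ eqn)))
  1+n≰n

-- As `n` is coprime to `m`, sending `s` to `(z + m * s) % n` is injective on the `n` residues,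
-- hence onto.
residue-surjective : ∀ {m n} .{{_ : NonZero n}} → Coprime n m → ∀ z c → ∃ λ s → s < n × (z + m * s) % n ≡ c % n
residue-surjective {m} {n} n⊥m z c with Fin-injective⇒surjective f f-inj (fromℕ< (m%n<n c n))
  where
  f : Fin n → Fin n
  f s = fromℕ< (m%n<n (z + m * toℕ s) n)
  f-inj : Injective _≡_ _≡_ f
  f-inj {s} {s′} eqn = Fin.toℕ-injective (∣m-n∣≡0⇒m≡n (small
    (coprime-divisor n⊥m (subst (n ∣_) diff (%-≡⇒∣∣-∣ n (Fin.fromℕ<-injective _ _ _ _ eqn))))))
    where
    diff : ∣ z + m * toℕ s - z + m * toℕ s′ ∣ ≡ m * ∣ toℕ s - toℕ s′ ∣
    diff = trans (∣m+n-m+o∣≡∣n-o∣ z _ _) (sym (*-distribˡ-∣-∣ m (toℕ s) (toℕ s′)))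
    below : ∣ toℕ s - toℕ s′ ∣ < n
    below = ≤-<-trans (∣m-n∣≤m⊔n (toℕ s) (toℕ s′)) (⊔-lub (Fin.toℕ<n s) (Fin.toℕ<n s′))
    small : n ∣ ∣ toℕ s - toℕ s′ ∣ → ∣ toℕ s - toℕ s′ ∣ ≡ 0
    small n∣ with ∣ toℕ s - toℕ s′ ∣ in eq₀
    ... | zero  = refl
    ... | suc k = contradiction (∣⇒≤ n∣) (<⇒≱ (subst (_< n) eq₀ below))
... | s , eqn = toℕ s , Fin.toℕ<n s , Fin.fromℕ<-injective _ _ _ _ eqn

-- Adding a multiple of the product of the moduli already treated preserves their residues, and
-- `residue-surjective` picks the multiple that is right for the new modulus. The form `suc ∘ f`
-- makes the moduli visibly nonzero.
chineseRemainder : ∀ (f : ℕ → ℕ) (c : ℕ → ℕ) {xs} → AllPairs (Coprime on (suc ∘ f)) xs →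
  ∃ λ z → z < product (map (suc ∘ f) xs) × (∀ {x} → x ∈ xs → z % suc (f x) ≡ c x % suc (f x))
chineseRemainder f c [] = 0 , s≤s z≤n , λ ()
chineseRemainder f c {x ∷ xs} (x⊥ ∷ xs⊥)
  with chineseRemainder f c xs⊥
... | z , z< , z≡
  with residue-surjective (coprime-product (suc ∘ f) x⊥) z (c x)
... | s , s< , eqn = z + Π * s , bound , λ
  { (here refl) → eqn
  ; (there y∈)  → trans (%-remove-+ʳ z (∣m⇒∣m*n s (∈⇒∣product (∈-map⁺ (suc ∘ f) y∈)))) (z≡ y∈) }
  where
  Π = product (map (suc ∘ f) xs)
  open ≤-Reasoning
  bound : z + Π * s < suc (f x) * Π
  bound = begin-strict
    z + Π * s       <⟨ +-monoˡ-< (Π * s) z< ⟩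
    Π + Π * s       ≡⟨ *-suc Π s ⟨
    Π * suc s       ≤⟨ *-monoʳ-≤ Π s< ⟩
    Π * suc (f x)   ≡⟨ *-comm Π _ ⟩
    suc (f x) * Π   ∎

-- Choosing the parameters of a separating map

position : List ℕ → ℕ → ℕ
position [] x = 0
position (y ∷ ys) x with x ≟ y
... | yes _ = 0
... | no  _ = suc (position ys x)

position< : ∀ {xs x} → x ∈ xs → position xs x < length xs
position< {y ∷ ys} {x} x∈ with x ≟ y | x∈
... | yes _  | _ = s≤s z≤n
... | no x≢y | here eqn = contradiction eqn x≢y
... | no _   | there x∈′ = s≤s (position< x∈′)

position-injective : ∀ {xs x x′} → x ∈ xs → x′ ∈ xs → position xs x ≡ position xs x′ → x ≡ x′
position-injective {y ∷ ys} {x} {x′} x∈ x′∈ eqn with x ≟ y | x′ ≟ y | x∈ | x′∈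
... | yes refl | yes refl | _ | _ = refl
... | no x≢ | _ | here e | _ = contradiction e x≢
... | no _ | no x′≢ | _ | here e = contradiction e x′≢
... | no _ | no _ | there p | there p′ = position-injective p p′ (suc-injective eqn)

^-mono-product : ∀ {A : Set} (f : A → ℕ) b xs → (∀ {x} → x ∈ xs → b ≤ f x) →
  b ^ length xs ≤ product (map f xs)
^-mono-product f b [] _ = ≤-refl
^-mono-product f b (x ∷ xs) le = *-mono-≤ (le (here refl)) (^-mono-product f b xs (le ∘ there))

-- If all betaModulus u i with i < t divided Δ, so would their product, which exceeds u ^ t.
nondivisor : ∀ t {u Δ} → spread (upTo t) ∣ u → 0 < Δ → Δ < u ^ t →
  ∃ λ i → i < t × betaModulus u i ∤ Δ
nondivisor t {u} {Δ} s∣u Δ>0 Δ< with all? (λ i → betaModulus u i ∣? Δ) (upTo t)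
... | no ¬all with find (All.¬All⇒Any¬ (λ i → betaModulus u i ∣? Δ) _ ¬all)
...   | i , i∈ , ∤Δ = i , ∈-upTo⁻ i∈ , ∤Δ
nondivisor t {u} {Δ} s∣u Δ>0 Δ< | yes divs = contradiction Δ< (≤⇒≯ (begin
  u ^ t                                  ≡⟨ cong (u ^_) (length-upTo t) ⟨
  u ^ length (upTo t)                    ≤⟨ ^-mono-product (betaModulus u) u (upTo t)
                                              (λ {i} _ → m≤n⇒m≤1+n (m≤m+n u (i * u))) ⟩
  product (map (betaModulus u) (upTo t)) ≤⟨ ∣⇒≤ {{>-nonZero Δ>0}} (product-∣ (betaModulus u)
                                              (betaModuli-coprime (Unique.upTo⁺ t) s∣u) (All.lookup divs)) ⟩
  Δ                                      ∎))
  where open ≤-Reasoning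

bracket : ∀ (f : ℕ → ℕ) {a n} d → f a ≤ n → n < f (d + a) → ∃ λ v → a ≤ v × f v ≤ n × n < f (suc v)
bracket f zero fa≤n n<f = contradiction n<f (≤⇒≯ fa≤n)
bracket f {a} {n} (suc d) fa≤n n<f with f (d + a) ≤? n
... | yes ≤n = d + a , m≤n+m a d , ≤n , n<f
... | no  ≰n = bracket f d fa≤n (≰⇒> ≰n)

-- The bounds by `n` make the parameters `suc p`, `u`, `z` and every second modulus minus one
-- elements of a structure of size `n`; the bound by `g` lets constants name the values taken on
-- `xs`.
Separation : ℕ → ℕ → List ℕ → Set
Separation g n xs = ∃ λ p → ∃ λ u → ∃ λ z → suc p < n × u < n × z < n ×
  (∀ x → suc (x % suc p) * u < n) ×
  (∀ {x} → x ∈ xs → z % betaModulus u (x % suc p) < g) ×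
  (∀ {x y} → x ∈ xs → y ∈ xs →
    z % betaModulus u (x % suc p) ≡ z % betaModulus u (y % suc p) → x ≡ y)

module _ (g : ℕ) where
  private
    -- `z` will be bounded by a product of at most `g` moduli, each at most `P ^ (3 + g * g)`;
    -- `suc g` in place of `g` keeps `exponent` at least `3 + g * g` when `g` is 0. `count` is the
    -- number of candidates for the first modulus, `K` makes them pairwise coprime, and `factor` is
    -- chosen to give `P ≤ factor * v`.
    exponent count K factor threshold : ℕ
    exponent = (3 + g * g) * suc g
    count    = suc (g + 2 * (exponent * (g * g)))
    K        = spread (upTo count)
    factor   = suc (count * K)

    -- The value at `factor + factor` of the function bracketed in `scale`, so that the search for
    -- `v` can start there.
    threshold = (factor * (factor + factor)) ^ exponent

    scale : ∀ {n} → threshold ≤ n → ∃ λ v →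
      factor + factor ≤ v × (factor * v) ^ exponent ≤ n × n < (factor * suc v) ^ exponent
    scale {n} n≥ = bracket (λ v → (factor * v) ^ exponent) n n≥ (begin-strict
      n                                              <⟨ m<m+n n (s≤s z≤n) ⟩
      n + (factor + factor)                          ≤⟨ m≤n*m _ factor ⟩
      base                                           ≤⟨ m≤m*n base _ {{m^n≢0 base (pred exponent) {{base≢0}}}} ⟩
      base ^ exponent                                ∎)
      where
      open ≤-Reasoning
      base : ℕ
      base = factor * (n + (factor + factor))
      base≢0 : NonZero base
      base≢0 = m*n≢0 factor (n + (factor + factor)) {{_}}
        {{>-nonZero (≤-trans (s≤s z≤n) (m≤n+m (factor + factor) n))}}

    -- v is of size about n ^ (1 / exponent): large enough for n ^ (g * g) to stay below
    -- v ^ count, small enough for the products over the residues modulo p to stay below n.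
    module Choice {n v : ℕ} (v≥ : factor + factor ≤ v)
      (n≥ : (factor * v) ^ exponent ≤ n) (n< : n < (factor * suc v) ^ exponent) where
      open ≤-Reasoning

      P : ℕ
      P = suc (count * (v * K))

      1<v : 1 < v
      1<v = ≤-trans (+-mono-≤ {1} {factor} {1} (s≤s z≤n) (s≤s z≤n)) v≥

      v≤vK : v ≤ v * K
      v≤vK = m≤m*n v K {{>-nonZero (spread>0 (upTo count))}}

      g<P : suc g ≤ P
      g<P = s≤s (begin
        g                ≤⟨ ≤-trans (m≤m+n g _) (n≤1+n _) ⟩
        count            ≤⟨ m≤m*n count (v * K) {{>-nonZero (≤-trans (<⇒≤ 1<v) v≤vK)}} ⟩
        count * (v * K)  ∎)

      2≤P : 2 ≤ P
      2≤P = s≤s (≤-trans (≤-trans (<⇒≤ 1<v) v≤vK) (m≤m+n (v * K) _))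

      P^≤n : P ^ exponent ≤ n
      P^≤n = ≤-trans (^-monoˡ-≤ exponent (begin
        suc (count * (v * K))  ≡⟨ cong suc (rearrange count v K) ⟩
        suc (count * K * v)    ≤⟨ +-monoˡ-≤ (count * K * v) (<⇒≤ 1<v) ⟩
        factor * v             ∎)) n≥
        where
        rearrange : ∀ a b c → a * (b * c) ≡ a * c * b
        rearrange = solve-∀

      -- From `v ≥ factor + factor` follows `factor * suc v ≤ v ^ 2`, so `n` is below
      -- `v ^ (2 * exponent)`, and `count` exceeds `2 * (exponent * (g * g))`.
      n^<u^ : n ^ (g * g) < (v * K) ^ count
      n^<u^ = begin-strict
        n ^ (g * g)                                          ≤⟨ ^-monoˡ-≤ (g * g) (<⇒≤ n<) ⟩
        ((factor * suc v) ^ exponent) ^ (g * g)              ≡⟨ ^-*-assoc (factor * suc v) exponent (g * g) ⟩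
        (factor * suc v) ^ (exponent * (g * g))              ≤⟨ ^-monoˡ-≤ (exponent * (g * g)) base≤ ⟩
        (v ^ 2) ^ (exponent * (g * g))                       ≡⟨ ^-*-assoc v 2 (exponent * (g * g)) ⟩
        v ^ (2 * (exponent * (g * g)))                       <⟨ ^-monoʳ-< v 1<v (s≤s (m≤n+m _ g)) ⟩
        v ^ count                                            ≤⟨ ^-monoˡ-≤ count v≤vK ⟩
        (v * K) ^ count                                      ∎
        where
        base≤ : factor * suc v ≤ v ^ 2
        base≤ = begin
          factor * suc v           ≡⟨ *-suc factor v ⟩
          factor + factor * v      ≤⟨ +-monoˡ-≤ (factor * v) (m≤m*n factor v {{>-nonZero (<⇒≤ 1<v)}}) ⟩
          factor * v + factor * v  ≡⟨ *-distribʳ-+ v factor factor ⟨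
          (factor + factor) * v    ≤⟨ *-monoˡ-≤ v v≥ ⟩
          v * v                    ≡⟨ cong (v *_) (*-identityʳ v) ⟨
          v ^ 2                    ∎

  separation : ∀ n → threshold ≤ n → ∀ xs → All (_< n) xs → length xs ≤ g → Separation g n xs
  separation n n≥ xs xs<n len with scale n≥
  ... | v , v≥ , lo , hi
    with nondivisor count (n∣m*n v) (spread>0 xs) (≤-<-trans (spread-≤ xs n>0 xs<n len) (Choice.n^<u^ v≥ lo hi))
    where
    n>0 : 0 < n
    n>0 = ≤-trans (m^n>0 _ exponent) (Choice.P^≤n v≥ lo hi)
  ... | i , i< , ∤spread =
    p , u , z , ≤-trans (s≤s (m≤m*n (suc p) u)) pu<n , ≤-trans (s≤s (m≤n*m u (suc p))) pu<n , z<n ,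
    (λ x → ≤-<-trans (*-monoˡ-≤ u (m%n<n x (suc p))) pu<n) ,
    (λ x∈ → subst (_< g) (sym (residue x∈)) (<-≤-trans (position< (y∈ys x∈)) ys-length)) ,
    λ x∈ y∈ eqn → mod-injective x∈ y∈ (position-injective (y∈ys x∈) (y∈ys y∈)
      (trans (sym (residue x∈)) (trans eqn (residue y∈))))
    where
    open Choice {n} {v} v≥ lo hi
    open ≤-Reasoning
    -- Thus `suc p` is `betaModulus (v * K) i`, which does not divide `spread xs`; hence reduction
    -- modulo `suc p` is injective on `xs`.
    p = suc i * (v * K)
    ys = deduplicate _≟_ (map (_% suc p) xs)
    -- The factor `spread ys` makes the moduli belonging to `ys` pairwise coprime; the factor
    -- `suc g` makes them exceed all positions in `ys`, so these are not changed by the reduction.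
    u = suc g * spread ys
    p≤P : suc p ≤ P
    p≤P = s≤s (*-monoˡ-≤ (v * K) i<)
    ys-length : length ys ≤ g
    ys-length = ≤-trans (length-deduplicate _≟_ (map (_% suc p) xs)) (≤-trans (≤-reflexive (length-map _ xs)) len)
    y∈ys : ∀ {x} → x ∈ xs → x % suc p ∈ ys
    y∈ys x∈ = ∈-deduplicate⁺ _≟_ (∈-map⁺ (_% suc p) x∈)
    ys<P : All (_< P) ys
    ys<P = All.tabulate below
      where
      below : ∀ {y} → y ∈ ys → y < P
      below y∈ with ∈-map⁻ (_% suc p) (∈-deduplicate⁻ _≟_ (map (_% suc p) xs) y∈)
      ... | x , _ , refl = ≤-trans (m%n<n x (suc p)) p≤P
    instance
      u≢0 : NonZero u
      u≢0 = m*n≢0 (suc g) (spread ys) {{_}} {{>-nonZero (spread>0 ys)}}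
    -- Here `u ≤ P * P ^ (g * g)`; the third factor `P` yields strictness, which absorbs the `suc`
    -- in `betaModulus`.
    Pu< : P * u < P ^ (3 + g * g)
    Pu< = begin-strict
      P * u                     ≤⟨ *-monoʳ-≤ P (*-mono-≤ g<P (spread-≤ ys (s≤s z≤n) ys<P ys-length)) ⟩
      P ^ (2 + g * g)           <⟨ ^-monoʳ-< P 2≤P (n<1+n (2 + g * g)) ⟩
      P ^ (3 + g * g)           ∎
    P^3≤n : P ^ (3 + g * g) ≤ n
    P^3≤n = ≤-trans (^-monoʳ-≤ P (m≤m*n (3 + g * g) (suc g))) P^≤n
    pu<n : suc p * u < n
    pu<n = <-≤-trans (≤-<-trans (*-monoˡ-≤ u p≤P) Pu<) P^3≤n
    solution = chineseRemainder (λ y → suc y * u) (position ys)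
      (betaModuli-coprime (UniqueDecP.deduplicate-! _≟_ (map (_% suc p) xs)) (n∣m*n (suc g)))
    z = proj₁ solution
    z<n : z < n
    z<n = begin-strict
      z                                   <⟨ proj₁ (proj₂ solution) ⟩
      product (map (betaModulus u) ys)    ≤⟨ product-≤ (map (betaModulus u) ys) (suc g) (m^n>0 P (3 + g * g))
                                               (All.map⁺ (All.map (λ y< → ≤-<-trans (*-monoˡ-≤ u y<) Pu<) ys<P))
                                               (≤-trans (≤-reflexive (length-map _ ys)) (m≤n⇒m≤1+n ys-length)) ⟩
      (P ^ (3 + g * g)) ^ suc g           ≡⟨ ^-*-assoc P (3 + g * g) (suc g) ⟩
      P ^ exponent                        ≤⟨ P^≤n ⟩
      n                                   ∎
    residue : ∀ {x} → x ∈ xs → z % betaModulus u (x % suc p) ≡ position ys (x % suc p)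
    residue {x} x∈ = trans (proj₂ (proj₂ solution) (y∈ys x∈)) (m<n⇒m%n≡m (begin-strict
      position ys (x % suc p)     <⟨ position< (y∈ys x∈) ⟩
      length ys                   ≤⟨ ys-length ⟩
      g                           ≤⟨ n≤1+n g ⟩
      suc g                       ≤⟨ m≤m*n (suc g) (spread ys) {{>-nonZero (spread>0 ys)}} ⟩
      u                           ≤⟨ m≤m+n u _ ⟩
      suc (x % suc p) * u         <⟨ n<1+n _ ⟩
      betaModulus u (x % suc p)   ∎))
    mod-injective : ∀ {x y} → x ∈ xs → y ∈ xs → x % suc p ≡ y % suc p → x ≡ y
    mod-injective {x} {y} x∈ y∈ eqn with x ≟ y
    ... | yes x≡y = x≡y
    ... | no  x≢y = contradiction (∣-trans (%-≡⇒∣∣-∣ {x} {y} (suc p) eqn) (∣x-y∣∣spread x∈ y∈ x≢y)) ∤spread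

abstract
  -- Opaque because only the existence of a threshold matters below, and its value is far too large
  -- to unfold.
  separationThreshold : ∀ g → ∃ λ n₀ →
    ∀ n → n₀ ≤ n → ∀ xs → All (_< n) xs → length xs ≤ g → Separation g n xs
  separationThreshold g = _ , separation g

-- Bounded search trees

InjectiveOn : ∀ {A B : Set} → (A → B) → List A → Set
InjectiveOn f xs = ∀ {x y} → x ∈ xs → y ∈ xs → f x ≡ f y → x ≡ y

module _ {A : Set} where

  remove : ∀ {x : A} {xs} → x ∈ xs → ∃ λ ys → length xs ≡ suc (length ys) ×
    (∀ {y} → y ∈ xs → y ≡ x ⊎ y ∈ ys)
  remove {x} {_ ∷ xs} (here refl) = xs , refl , λ { (here eqn) → inj₁ eqn ; (there y∈) → inj₂ y∈ }
  remove {x} {z ∷ xs} (there x∈) with remove x∈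
  ... | ys , len , split = z ∷ ys , cong suc len , λ
    { (here eqn) → inj₂ (here eqn)
    ; (there y∈) → Sum.map₂ there (split y∈) }

  Unique-⊆⇒length≤ : ∀ {xs ys : List A} → Unique xs → xs ⊆ ys → length xs ≤ length ys
  Unique-⊆⇒length≤ [] _ = z≤n
  Unique-⊆⇒length≤ {x ∷ xs} {ys} (x∉ ∷ xs!) sub with remove (sub (here refl))
  ... | zs , len , split = subst (suc (length xs) ≤_) (sym len) (s≤s (Unique-⊆⇒length≤ xs! sub′))
    where
    sub′ : xs ⊆ zs
    sub′ y∈ with split (sub (there y∈))
    ... | inj₁ refl = contradiction refl (All.lookup x∉ y∈)
    ... | inj₂ y∈zs = y∈zs

  -- While `xs` is shorter than `ys`, the pigeonhole principle provides an entry of `ys` outside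
  -- `xs`.
  Unique-extend : DecidableEquality A → ∀ {ys : List A} → Unique ys → ∀ d {xs} → Unique xs →
    d + length xs ≡ length ys → ∃ λ zs → xs ⊆ zs × Unique zs × length zs ≡ length ys
  Unique-extend _≟_ ys! zero {xs} xs! len = xs , (λ x∈ → x∈) , xs! , len
  Unique-extend _≟_ {ys} ys! (suc d) {xs} xs! len with all? (λ y → Any.any? (y ≟_) xs) ys
  ... | yes ys⊆xs = contradiction (Unique-⊆⇒length≤ ys! (All.lookup ys⊆xs))
        (<⇒≱ (≤-trans (s≤s (m≤n+m (length xs) d)) (≤-reflexive len)))
  ... | no ¬ys⊆xs with find (All.¬All⇒Any¬ (λ y → Any.any? (y ≟_) xs) ys ¬ys⊆xs)
  ...   | y , _ , y∉xs
    with Unique-extend _≟_ ys! d {y ∷ xs} (All.¬Any⇒All¬ xs y∉xs ∷ xs!) (trans (+-suc d (length xs)) len)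
  ...     | zs , sub , zs! , len′ = zs , sub ∘ there , zs! , len′

unary : ∀ {B : Set} {r} → (Vec B r → Set) → (i : Fin 1) → Vec B (List.lookup (r ∷ []) i) → Set
unary Q zero = Q

-- Monotonicity and decidability of satisfaction

module _ {τ : Vocab} (A : Structure τ) where

  Sat-NoSO : ∀ {V m n c X Y} {env : Vec (Carrier A) n} (φ : Formula τ V m n) → NoSO φ →
    Sat A c X env φ → Sat A c Y env φ
  Sat-NoSO (rel R ts) _ s = s
  Sat-NoSO (eq t t′) _ s = s
  Sat-NoSO (neg φ) noSO s = λ s′ → s (Sat-NoSO φ noSO s′)
  Sat-NoSO (conj φ ψ) (noSO , noSO′) (s , s′) = Sat-NoSO φ noSO s , Sat-NoSO ψ noSO′ s′
  Sat-NoSO (disj φ ψ) (noSO , noSO′) (inj₁ s) = inj₁ (Sat-NoSO φ noSO s)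
  Sat-NoSO (disj φ ψ) (noSO , noSO′) (inj₂ s) = inj₂ (Sat-NoSO ψ noSO′ s)
  Sat-NoSO (exi φ) noSO (a , s) = a , Sat-NoSO φ noSO s
  Sat-NoSO (all φ) noSO s = λ a → Sat-NoSO φ noSO (s a)

  Sat-mono : ∀ {V m n c X Y} {env : Vec (Carrier A) n} (φ : Formula τ V m n) → SONotUnderExNeg φ →
    (∀ i ts → X i ts → Y i ts) → Sat A c X env φ → Sat A c Y env φ
  Sat-mono (rel R ts) _ X⊆Y s = s
  Sat-mono (eq t t′) _ X⊆Y s = s
  Sat-mono (sov i ts) _ X⊆Y s = X⊆Y i _ s
  Sat-mono (neg φ) noSO X⊆Y s = Sat-NoSO (neg φ) noSO s
  Sat-mono (conj φ ψ) (pos , pos′) X⊆Y (s , s′) = Sat-mono φ pos X⊆Y s , Sat-mono ψ pos′ X⊆Y s′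
  Sat-mono (disj φ ψ) (pos , pos′) X⊆Y (inj₁ s) = inj₁ (Sat-mono φ pos X⊆Y s)
  Sat-mono (disj φ ψ) (pos , pos′) X⊆Y (inj₂ s) = inj₂ (Sat-mono ψ pos′ X⊆Y s)
  Sat-mono (exi φ) noSO X⊆Y s = Sat-NoSO (exi φ) noSO s
  Sat-mono (all φ) pos X⊆Y s = λ a → Sat-mono φ pos X⊆Y (s a)

  -- Two occurrences of the absurd λ () : Fin 0 → Carrier A are only pointwise equal.
  evalT-consts : ∀ {m n} {c c′ : Fin m → Carrier A} {env : Vec (Carrier A) n} → (∀ j → c j ≡ c′ j) →
    ∀ t → evalT c env t ≡ evalT c′ env t
  evalT-consts c≗c′ (var i)   = refl
  evalT-consts c≗c′ (const j) = c≗c′ j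

  Sat-consts : ∀ {V m n c c′ X} {env : Vec (Carrier A) n} (φ : Formula τ V m n) → (∀ j → c j ≡ c′ j) →
    Sat A c X env φ → Sat A c′ X env φ
  Sat-consts (rel R ts) c≗c′ s = subst (T ∘ relI A R) (Vec.map-cong (evalT-consts c≗c′) ts) s
  Sat-consts (eq t t′) c≗c′ s = subst₂ _≡_ (evalT-consts c≗c′ t) (evalT-consts c≗c′ t′) s
  Sat-consts {X = X} (sov i ts) c≗c′ s = subst (X i) (Vec.map-cong (evalT-consts c≗c′) ts) s
  Sat-consts (neg φ) c≗c′ s = s ∘ Sat-consts φ (sym ∘ c≗c′)
  Sat-consts (conj φ ψ) c≗c′ (s , s′) = Sat-consts φ c≗c′ s , Sat-consts ψ c≗c′ s′
  Sat-consts (disj φ ψ) c≗c′ (inj₁ s) = inj₁ (Sat-consts φ c≗c′ s)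
  Sat-consts (disj φ ψ) c≗c′ (inj₂ s) = inj₂ (Sat-consts ψ c≗c′ s)
  Sat-consts (exi φ) c≗c′ (a , s) = a , Sat-consts φ c≗c′ s
  Sat-consts (all φ) c≗c′ s = λ a → Sat-consts φ c≗c′ (s a)

module Arithmetic {τ : Vocab} (A : Structure τ) (w : ArithIso A) where
  open ArithIso w

  index : Carrier A → Fin (suc N)
  index a = proj₁ (proj₂ ι-bij a)

  ι-index : ∀ a → ι (index a) ≡ a
  ι-index a = proj₂ (proj₂ ι-bij a) refl

  index-ι : ∀ i → index (ι i) ≡ i
  index-ι i = proj₁ ι-bij (ι-index (ι i))

  index-injective : ∀ {a b} → index a ≡ index b → a ≡ b
  index-injective {a} {b} eqn = trans (sym (ι-index a)) (trans (cong ι eqn) (ι-index b))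

  infix 4 _≟ᶜ_
  _≟ᶜ_ : DecidableEquality (Carrier A)
  a ≟ᶜ b = map′ index-injective (cong index) (index a Fin.≟ index b)

  any?ᶜ : ∀ {P : Carrier A → Set} → (∀ a → Dec (P a)) → Dec (Σ (Carrier A) P)
  any?ᶜ {P} P? = map′ (λ (i , p) → ι i , p) (λ (a , p) → index a , subst P (sym (ι-index a)) p)
    (Fin.any? (λ i → P? (ι i)))

  all?ᶜ : ∀ {P : Carrier A → Set} → (∀ a → Dec (P a)) → Dec (∀ a → P a)
  all?ᶜ {P} P? = map′ (λ f a → subst P (ι-index a) (f (index a))) (λ f i → f (ι i))
    (Fin.all? (λ i → P? (ι i)))


  Sat? : ∀ {V m n} {c : Fin m → Carrier A} {X} → (∀ i ts → Dec (X i ts)) →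
    (env : Vec (Carrier A) n) (φ : Formula τ V m n) → Dec (Sat A c X env φ)
  Sat? X? env (rel R ts) = T? _
  Sat? X? env (eq t t′) = _ ≟ᶜ _
  Sat? X? env (sov i ts) = X? i _
  Sat? X? env (neg φ) = ¬? (Sat? X? env φ)
  Sat? X? env (conj φ ψ) = Sat? X? env φ ×-dec Sat? X? env ψ
  Sat? X? env (disj φ ψ) = Sat? X? env φ ⊎-dec Sat? X? env ψ
  Sat? X? env (exi φ) = any?ᶜ (λ a → Sat? X? (a ∷ env) φ)
  Sat? X? env (all φ) = all?ᶜ (λ a → Sat? X? (a ∷ env) φ)

-- An upper bound for the number of `X`-atoms in one clause of the conjunctive normal form that
-- arises when universal quantifiers are instantiated. Negated and existential subformulas count 0,
-- as `X` does not occur in them in the formulas considered.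
clauseWidth : ∀ {τ V m n} → Formula τ V m n → ℕ
clauseWidth (rel R ts) = 0
clauseWidth (eq s t)   = 0
clauseWidth (sov i ts) = 1
clauseWidth (neg φ)    = 0
clauseWidth (conj φ ψ) = clauseWidth φ + clauseWidth ψ
clauseWidth (disj φ ψ) = clauseWidth φ + clauseWidth ψ
clauseWidth (exi φ)    = 0
clauseWidth (all φ)    = clauseWidth φ

-- Counts the at most `d` tuples of a falsified clause and those collected in the branches, one for
-- each of these tuples.
treeSize : ℕ → ℕ → ℕ
treeSize d zero    = d
treeSize d (suc k) = d + d * treeSize d k

-- Branching on falsified clauses

module SearchTree {τ : Vocab} (A : Structure τ) (w : ArithIso A) {r m : ℕ} (c : Fin m → Carrier A) where
  open Arithmetic A w

  Tuple : Set
  Tuple = Vec (Carrier A) r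

  _⊨[_]_ : ∀ {n} → Vec (Carrier A) n → (Tuple → Set) → Formula τ (r ∷ []) m n → Set
  env ⊨[ Q ] φ = Sat A c (unary Q) env φ

  ⊨-mono : ∀ {n} {env : Vec (Carrier A) n} {Q Q′} φ → SONotUnderExNeg φ →
    (∀ {t} → Q t → Q′ t) → env ⊨[ Q ] φ → env ⊨[ Q′ ] φ
  ⊨-mono φ pos Q⊆Q′ = Sat-mono A φ pos λ { zero t → Q⊆Q′ }

  ∈? : ∀ (S : List Tuple) (t : Tuple) → Dec (t ∈ S)
  ∈? S t = Any.any? (Vec.≡-dec _≟ᶜ_ t) S

  -- `Q` ranges over all predicates, not only over finite lists, so that it can later be
  -- `h t ∈ map h S ++ U`.
  FalsifiedClause : ∀ {n} → Vec (Carrier A) n → Formula τ (r ∷ []) m n → List Tuple → Set₁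
  FalsifiedClause env φ S = ∃ λ E → length E ≤ clauseWidth φ × All (_∉ S) E ×
    (∀ Q → env ⊨[ Q ] φ → Any Q E)

  -- A false subformula without `X` is false for every `Q`, which gives the empty clause. A false
  -- disjunction joins the clauses of both sides; a false conjunction or universal formula passes to
  -- one false conjunct or instance, found by decidability.
  falsifiedClause : ∀ {n} (env : Vec (Carrier A) n) φ → SONotUnderExNeg φ → ∀ S →
    ¬ env ⊨[ _∈ S ] φ → FalsifiedClause env φ S
  falsifiedClause env (rel R ts) _ S ¬s = [] , z≤n , [] , λ Q s → contradiction s ¬s
  falsifiedClause env (eq t t′) _ S ¬s = [] , z≤n , [] , λ Q s → contradiction s ¬s
  falsifiedClause env (sov zero ts) _ S ¬s = _ ∷ [] , ≤-refl , ¬s ∷ [] , λ Q s → here s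
  falsifiedClause env (neg φ) noSO S ¬s = [] , z≤n , [] , λ Q s → contradiction (Sat-NoSO A (neg φ) noSO s) ¬s
  falsifiedClause env (conj φ ψ) (pos , pos′) S ¬s with Sat? (λ { zero → ∈? S }) env φ
  ... | no ¬sφ with falsifiedClause env φ pos S ¬sφ
  ...   | E , len , E∉ , hit = E , ≤-trans len (m≤m+n _ _) , E∉ , λ Q → hit Q ∘ proj₁
  falsifiedClause env (conj φ ψ) (pos , pos′) S ¬s | yes sφ
    with falsifiedClause env ψ pos′ S (λ sψ → ¬s (sφ , sψ))
  ...   | E , len , E∉ , hit = E , ≤-trans len (m≤n+m _ _) , E∉ , λ Q → hit Q ∘ proj₂
  falsifiedClause env (disj φ ψ) (pos , pos′) S ¬s
    with falsifiedClause env φ pos S (¬s ∘ inj₁) | falsifiedClause env ψ pos′ S (¬s ∘ inj₂)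
  ... | E , len , E∉ , hit | E′ , len′ , E′∉ , hit′ =
    E ++ E′ , ≤-trans (≤-reflexive (length-++ E)) (+-mono-≤ len len′) , All.++⁺ E∉ E′∉ ,
    λ { Q (inj₁ s) → Any.++⁺ˡ (hit Q s) ; Q (inj₂ s) → Any.++⁺ʳ E (hit′ Q s) }
  falsifiedClause env (exi φ) noSO S ¬s = [] , z≤n , [] , λ Q s → contradiction (Sat-NoSO A (exi φ) noSO s) ¬s
  falsifiedClause env (all φ) pos S ¬s with any?ᶜ (λ a → ¬? (Sat? (λ { zero → ∈? S }) (a ∷ env) φ))
  ... | no none = ⊥-elim (¬s (λ a →
    decidable-stable (Sat? (λ { zero → ∈? S }) (a ∷ env) φ) (λ ¬sa → none (a , ¬sa))))
  ... | yes (a , ¬sa) with falsifiedClause (a ∷ env) φ pos S ¬sa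
  ...   | E , len , E∉ , hit = E , len , E∉ , λ Q s → hit Q (s a)

  module _ (H : Set) {n : ℕ} (env : Vec (Carrier A) n) (φ : Formula τ (r ∷ []) m n)
    (pos : SONotUnderExNeg φ) where

    Solution : ℕ → List Tuple → Set
    Solution k S = ∃ λ S′ → length S′ ≤ k × env ⊨[ _∈ S′ ++ S ] φ

    -- Injectivity on `W ++ S` excludes collisions between `W` and `S`, so the value of a tuple of
    -- `W` outside `S` can only be supplied by `U`.
    Refutes : ℕ → List Tuple → List Tuple → Set
    Refutes k S W = ∀ (h : Tuple → H) → InjectiveOn h (W ++ S) →
      ∀ U → length U ≤ k → ¬ env ⊨[ (λ t → h t ∈ map h S ++ U) ] φ

    Refutable : ℕ → ℕ → List Tuple → Set
    Refutable b k S = ∃ λ W → length W ≤ b × Refutes k S W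


    -- Injectivity on a larger list restricts to `W′`, so the refutations of all branches can share
    -- a single list `W`.
    RefutedWithin : ℕ → List Tuple → List Tuple → Tuple → Set
    RefutedWithin k S W e = ∃ λ W′ → W′ ⊆ W × Refutes k (e ∷ S) W′

    RefutedWithin-⊆ : ∀ {k S W W₁ e} → W ⊆ W₁ → RefutedWithin k S W e → RefutedWithin k S W₁ e
    RefutedWithin-⊆ sub (W′ , sub′ , ref) = W′ , (λ x∈ → sub (sub′ x∈)) , ref

    branches : ∀ {b k S} → (∀ S → Solution k S ⊎ Refutable b k S) → ∀ E →
      Solution (suc k) S ⊎ (∃ λ W → length W ≤ length E * b × All (RefutedWithin k S W) E)
    branches rec [] = inj₂ ([] , z≤n , [])
    branches {S = S} rec (e ∷ E) with rec (e ∷ S) | branches rec E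
    ... | inj₁ (S′ , len , s) | _ = inj₁ (e ∷ S′ , s≤s len , ⊨-mono φ pos move s)
      where
      move : ∀ {t} → t ∈ S′ ++ e ∷ S → t ∈ e ∷ S′ ++ S
      move t∈ with ∈-++⁻ S′ t∈
      ... | inj₁ t∈S′ = there (∈-++⁺ˡ t∈S′)
      ... | inj₂ (here eqn) = here eqn
      ... | inj₂ (there t∈S) = there (∈-++⁺ʳ S′ t∈S)
    ... | inj₂ _ | inj₁ sol = inj₁ sol
    ... | inj₂ (W , len , ref) | inj₂ (W′ , len′ , refs) = inj₂
      ( W ++ W′ , ≤-trans (≤-reflexive (length-++ W)) (+-mono-≤ len len′)
      , (W , ∈-++⁺ˡ , ref) ∷ All.map (RefutedWithin-⊆ (∈-++⁺ʳ W)) refs)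

    -- If `φ` held under a hashed reading, some `e` of the falsified clause would have its value in
    -- `map h S ++ U`. A value in `map h S` forces `e ∈ S` by injectivity, which is false. Otherwise
    -- that value is moved from `U` to the side of `S`, and the refutation of the branch at `e`
    -- applies with one element less in `U`.
    solution-or-refutation : ∀ k S → Solution k S ⊎ Refutable (treeSize (clauseWidth φ) k) k S
    solution-or-refutation k S with Sat? (λ { zero → ∈? S }) env φ
    ... | yes s = inj₁ ([] , z≤n , s)
    ... | no ¬s with falsifiedClause env φ pos S ¬s
    solution-or-refutation zero S | no ¬s | E , len , E∉ , hit = inj₂ (E , len , refutes)
      where
      refutes : Refutes 0 S E
      refutes h inj [] _ s with find (hit _ s)
      ... | e , e∈ , he∈ with ∈-map⁻ h (subst (h e ∈_) (++-identityʳ (map h S)) he∈)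
      ...   | t , t∈ , eqn = All.lookup E∉ e∈ (subst (_∈ S) (sym (inj (∈-++⁺ˡ e∈) (∈-++⁺ʳ E t∈) eqn)) t∈)
    solution-or-refutation (suc k) S | no ¬s | E , len , E∉ , hit
      with branches {S = S} (solution-or-refutation k) E
    ... | inj₁ sol = inj₁ sol
    ... | inj₂ (W , len′ , refs) = inj₂
      (E ++ W , ≤-trans (≤-reflexive (length-++ E)) (+-mono-≤ len (≤-trans len′ (*-monoˡ-≤ _ len))) , refutes)
      where
      refutes : Refutes (suc k) S (E ++ W)
      refutes h inj U lenU s with find (hit _ s)
      ... | e , e∈ , he∈ with ∈-++⁻ (map h S) he∈
      ...   | inj₁ he∈S with ∈-map⁻ h he∈S
      ...     | t , t∈ , eqn = All.lookup E∉ e∈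
                (subst (_∈ S) (sym (inj (∈-++⁺ˡ (∈-++⁺ˡ e∈)) (∈-++⁺ʳ (E ++ W) t∈) eqn)) t∈)
      refutes h inj U lenU s | e , e∈ , he∈ | inj₂ he∈U with remove he∈U | All.lookup refs e∈
      ...     | U′ , lenU′ , split | W′ , W′⊆W , ref = ref h
                (λ x∈ y∈ → inj (incl x∈) (incl y∈)) U′
                (s≤s⁻¹ (subst (_≤ suc k) lenU′ lenU)) (⊨-mono φ pos move s)
        where
        incl : W′ ++ e ∷ S ⊆ (E ++ W) ++ S
        incl x∈ with ∈-++⁻ W′ x∈
        ... | inj₁ x∈W′ = ∈-++⁺ˡ (∈-++⁺ʳ E (W′⊆W x∈W′))
        ... | inj₂ (here refl) = ∈-++⁺ˡ (∈-++⁺ˡ e∈)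
        ... | inj₂ (there x∈S) = ∈-++⁺ʳ (E ++ W) x∈S
        move : ∀ {t} → h t ∈ map h S ++ U → h t ∈ h e ∷ map h S ++ U′
        move ht∈ with ∈-++⁻ (map h S) ht∈
        ... | inj₁ ht∈S = there (∈-++⁺ˡ ht∈S)
        ... | inj₂ ht∈U with split ht∈U
        ...   | inj₁ eqn = here eqn
        ...   | inj₂ ht∈U′ = there (∈-++⁺ʳ (map h S) ht∈U′)

-- Hashing formulas

remainder-unique : ∀ {z d} q r → r ≤ d → z ≡ r + q * suc d → z % suc d ≡ r
remainder-unique {d = d} q r r≤d refl = trans ([m+kn]%n≡m%n r q (suc d)) (m<n⇒m%n≡m (s≤s r≤d))

does-≡⇒ : ∀ {P Q : Set} (P? : Dec P) (Q? : Dec Q) → does P? ≡ does Q? → P → Q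
does-≡⇒ _       (yes q) _ _ = q
does-≡⇒ (no ¬p) (no _)  _ p = contradiction p ¬p

toℕ-clamp : ∀ {ℓ N} → ℓ ≤ N → toℕ (clamp ℓ N) ≡ ℓ
toℕ-clamp z≤n = refl
toℕ-clamp (s≤s ℓ≤N) = cong suc (toℕ-clamp ℓ≤N)

module Values {τ : Vocab} (A : Structure τ) (w : ArithIso A) where
  open ArithIso w
  open Arithmetic A w public

  val : Carrier A → ℕ
  val a = toℕ (index a)

  val< : ∀ a → val a < suc N
  val< a = Fin.toℕ<n (index a)

  val-injective : ∀ {a b} → val a ≡ val b → a ≡ b
  val-injective eqn = index-injective (Fin.toℕ-injective eqn)

  element : ∀ {v} → v < suc N → ∃ λ a → val a ≡ v
  element v< = ι (fromℕ< v<) , trans (cong toℕ (index-ι _)) (Fin.toℕ-fromℕ< v<)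

  val-lt : ∀ {a b} → T (relI A lt (a ∷ b ∷ [])) ⇔ val a < val b
  val-lt {a} {b} = subst₂ (λ x y → T (relI A lt (x ∷ y ∷ [])) ⇔ val a < val b)
    (ι-index a) (ι-index b) (ι-lt _ _)

  val-plus : ∀ {a b c} → T (relI A plus (a ∷ b ∷ c ∷ [])) ⇔ val c ≡ val a + val b
  val-plus {a} {b} {c} = subst (λ z → T (relI A plus (a ∷ b ∷ z ∷ [])) ⇔ val c ≡ val a + val b) (ι-index c)
    (subst₂ (λ x y → T (relI A plus (x ∷ y ∷ _ ∷ [])) ⇔ val c ≡ val a + val b)
      (ι-index a) (ι-index b) (ι-add _ _ _))

  val-times : ∀ {a b c} → T (relI A times (a ∷ b ∷ c ∷ [])) ⇔ val c ≡ val a * val b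
  val-times {a} {b} {c} = subst (λ z → T (relI A times (a ∷ b ∷ z ∷ [])) ⇔ val c ≡ val a * val b) (ι-index c)
    (subst₂ (λ x y → T (relI A times (x ∷ y ∷ _ ∷ [])) ⇔ val c ≡ val a * val b)
      (ι-index a) (ι-index b) (ι-mul _ _ _))

  val-const : ∀ {m} (ℓ : Fin m) → toℕ ℓ ≤ N → val (constsC w m ℓ) ≡ toℕ ℓ
  val-const ℓ ℓ≤N = trans (cong toℕ (index-ι _)) (toℕ-clamp ℓ≤N)

module Formulas {τ : Vocab} {m′ : ℕ} where

  m : ℕ
  m = suc m′

  -- ℓ = z mod (1 + (y + 1) u) for y = x mod p; the quantifiers bind, in this order,
  -- ⌊x / p⌋, p ⌊x / p⌋, y, y u, w = (y + 1) u, b = ⌊z / (w + 1)⌋, b w and b (w + 1).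
  remainder : ∀ {n} (p u z x : Fin n) (ℓ : Fin m) → Formula τ [] m n
  remainder p u z x ℓ =
    exi (exi (exi (conj (rel times (v 2 ∷ var (3 ↑ʳ p) ∷ v 1 ∷ []))
                  (conj (rel plus (v 1 ∷ v 0 ∷ var (3 ↑ʳ x) ∷ []))
                  (conj (rel lt (v 0 ∷ var (3 ↑ʳ p) ∷ []))
    (exi (exi     (conj (rel times (v 2 ∷ var (5 ↑ʳ u) ∷ v 1 ∷ []))
                  (conj (rel plus (var (5 ↑ʳ u) ∷ v 1 ∷ v 0 ∷ []))
    (exi (exi (exi (conj (rel times (v 2 ∷ v 3 ∷ v 1 ∷ []))
                  (conj (rel plus (v 2 ∷ v 1 ∷ v 0 ∷ []))
                  (conj (rel plus (const ℓ ∷ v 0 ∷ var (8 ↑ʳ z) ∷ []))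
                        (neg (rel lt (v 3 ∷ const ℓ ∷ []))))))))))))))))))
    where
    v : ∀ {n} i {i< : True (i <? n)} → Term m n
    v i {i<} = var ((# i) {m<n = i<})

  -- The parameter value `p = 0` switches to naming elements by constants, as is done in small
  -- structures; `remainder` is then false, since it asks for some `y < p`.
  bit : ∀ {n} (p u z x : Fin n) (ℓ : Fin m) → Formula τ [] m n
  bit p u z x ℓ = disj (conj (eq (var p) (const zero)) (eq (var x) (const ℓ))) (remainder p u z x ℓ)

  verum : ∀ {n} → Formula τ [] m n
  verum = eq (const zero) (const zero)

  ⋀ ⋁ : ∀ {n} → List (Formula τ [] m n) → Formula τ [] m n
  ⋀ = List.foldr conj verum
  ⋁ = List.foldr disj (neg verum)

  literal : ∀ {n} → Bool → Formula τ [] m n → Formula τ [] m n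
  literal b φ = if b then φ else neg φ

  -- Recording the truth value of every bit makes the hash a total map into a finite set for all
  -- parameters, even those for which several bits or none hold.
  Code : Set
  Code = Vec Bool m

  coded : ∀ {n} (p u z x : Fin n) → Code → Formula τ [] m n
  coded p u z x v = ⋀ (map (λ ℓ → literal (Vec.lookup v ℓ) (bit p u z x ℓ)) (allFin m))

  codedTuple : ∀ {n r} (p u z : Fin n) → Vec (Fin n) r → Vec Code r → Formula τ [] m n
  codedTuple p u z [] [] = verum
  codedTuple p u z (x ∷ xs) (v ∷ s) = conj (coded p u z x v) (codedTuple p u z xs s)

  -- Coordinates are hashed independently, so their quantifiers stand side by side and the rank does
  -- not grow with `r`.
  realised : ∀ {n r} (p u z : Fin n) → Vec Code r → Formula τ [] m n
  realised p u z [] = verum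
  realised p u z (v ∷ s) = conj (exi (coded (suc p) (suc u) (suc z) zero v)) (realised p u z s)

  variable-of : ∀ {n} → Term 0 n → Fin n
  variable-of (var i) = i

  translateTerm : ∀ {n} → Term 0 n → Term m (n + 3)
  translateTerm t = var (variable-of t ↑ˡ 3)

  -- The three parameters come last in the context, so their position among the free variables is
  -- stable when quantifiers push new variables in front.
  translate : ∀ {r n} → List (Vec Code r) → Formula τ (r ∷ []) 0 n → Formula τ [] m (n + 3)
  translate S (rel R ts) = rel R (Vec.map translateTerm ts)
  translate S (eq s t) = eq (translateTerm s) (translateTerm t)
  translate {n = n} S (sov zero ts) =
    ⋁ (map (codedTuple (n ↑ʳ # 0) (n ↑ʳ # 1) (n ↑ʳ # 2) (Vec.map (λ t → variable-of t ↑ˡ 3) ts)) S)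
  translate S (neg φ) = neg (translate S φ)
  translate S (conj φ ψ) = conj (translate S φ) (translate S ψ)
  translate S (disj φ ψ) = disj (translate S φ) (translate S ψ)
  translate S (exi φ) = exi (translate S φ)
  translate S (all φ) = all (translate S φ)

  -- The rank of a conjunction is a maximum; hence the number of conjuncts, which grows with `k`,
  -- does not affect it.
  qr-⋀ : ∀ {n q} (φs : List (Formula τ [] m n)) → All (λ φ → qr φ ≤ q) φs → qr (⋀ φs) ≤ q
  qr-⋀ [] [] = z≤n
  qr-⋀ (φ ∷ φs) (φ≤ ∷ φs≤) = ⊔-lub φ≤ (qr-⋀ φs φs≤)

  qr-⋁ : ∀ {n q} (φs : List (Formula τ [] m n)) → All (λ φ → qr φ ≤ q) φs → qr (⋁ φs) ≤ q
  qr-⋁ [] [] = z≤n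
  qr-⋁ (φ ∷ φs) (φ≤ ∷ φs≤) = ⊔-lub φ≤ (qr-⋁ φs φs≤)

  qr-coded : ∀ {n} (p u z x : Fin n) v → qr (coded p u z x v) ≤ 8
  qr-coded p u z x v = qr-⋀ _ (All.map⁺ (All.universal bound (allFin m)))
    where
    bound : ∀ ℓ → qr (literal (Vec.lookup v ℓ) (bit p u z x ℓ)) ≤ 8
    bound ℓ with Vec.lookup v ℓ
    ... | true  = ≤-refl
    ... | false = ≤-refl

  qr-codedTuple : ∀ {n r} (p u z : Fin n) (xs : Vec (Fin n) r) s → qr (codedTuple p u z xs s) ≤ 8
  qr-codedTuple p u z [] [] = z≤n
  qr-codedTuple p u z (x ∷ xs) (v ∷ s) = ⊔-lub (qr-coded p u z x v) (qr-codedTuple p u z xs s)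

  qr-realised : ∀ {n r} (p u z : Fin n) (s : Vec Code r) → qr (realised p u z s) ≤ 9
  qr-realised p u z [] = z≤n
  qr-realised p u z (v ∷ s) = ⊔-lub (s≤s (qr-coded (suc p) (suc u) (suc z) zero v)) (qr-realised p u z s)

  qr-translate : ∀ {r n} S (φ : Formula τ (r ∷ []) 0 n) → qr (translate S φ) ≤ qr φ + 8
  qr-translate S (rel R ts) = z≤n
  qr-translate S (eq s t) = z≤n
  qr-translate {n = n} S (sov zero ts) = qr-⋁ _ (All.map⁺ (All.universal
    (qr-codedTuple (n ↑ʳ # 0) (n ↑ʳ # 1) (n ↑ʳ # 2) (Vec.map (λ t → variable-of t ↑ˡ 3) ts)) S))
  qr-translate S (neg φ) = qr-translate S φ
  qr-translate S (conj φ ψ) = ⊔-lub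
    (≤-trans (qr-translate S φ) (+-monoˡ-≤ 8 (m≤m⊔n (qr φ) (qr ψ))))
    (≤-trans (qr-translate S ψ) (+-monoˡ-≤ 8 (m≤n⊔m (qr φ) (qr ψ))))
  qr-translate S (disj φ ψ) = ⊔-lub
    (≤-trans (qr-translate S φ) (+-monoˡ-≤ 8 (m≤m⊔n (qr φ) (qr ψ))))
    (≤-trans (qr-translate S ψ) (+-monoˡ-≤ 8 (m≤n⊔m (qr φ) (qr ψ))))
  qr-translate S (exi φ) = s≤s (qr-translate S φ)
  qr-translate S (all φ) = s≤s (qr-translate S φ)

-- Correctness of the hashing formulas

module Semantics {τ : Vocab} (A : Structure τ) (w : ArithIso A) (m′ : ℕ)
  (None : (i : Fin 0) → Vec (Carrier A) (List.lookup [] i) → Set) where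
  open ArithIso w
  open Values A w
  open Formulas {τ} {m′}

  private
    c : Fin m → Carrier A
    c = constsC w m

  infix 4 _⊨_
  _⊨_ : ∀ {n} → Vec (Carrier A) n → Formula τ [] m n → Set
  env ⊨ φ = Sat A c None env φ

  _⊨?_ : ∀ {n} (env : Vec (Carrier A) n) φ → Dec (env ⊨ φ)
  env ⊨? φ = Sat? (λ ()) env φ

  remainder-sound : ∀ {n} {env : Vec (Carrier A) n} {p u z x ℓ} → env ⊨ remainder p u z x ℓ →
    let val′ = λ i → val (Vec.lookup env i) in
    ∃ λ p′ → val′ p ≡ suc p′ × val (c ℓ) ≡ val′ z % betaModulus (val′ u) (val′ x % suc p′)
  remainder-sound {env = env} {p} {u} {z} {x} {ℓ}
    (a , ap , y , ap≡ , x≡ , y<p , yu , w , yu≡ , w≡ , b , bw , e , bw≡ , e≡ , z≡ , w≮ℓ)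
    with val (Vec.lookup env p) | to val-times ap≡ | to val-lt y<p
  -- The value of `p` cannot be 0, because `y` lies below it.
  ... | suc p′ | ap≡′ | y<p′ = p′ , refl ,
    sym (trans (cong (λ r → val (Vec.lookup env z) % betaModulus (val (Vec.lookup env u)) r) y≡) ℓ≡)
    where
    open ≡-Reasoning
    y≡ : val (Vec.lookup env x) % suc p′ ≡ val y
    y≡ = remainder-unique (val a) (val y) (s≤s⁻¹ y<p′)
      (trans (to val-plus x≡) (trans (cong (_+ val y) ap≡′) (+-comm _ (val y))))
    w≡′ : val w ≡ suc (val y) * val (Vec.lookup env u)
    w≡′ = trans (to val-plus w≡) (cong (val (Vec.lookup env u) +_) (to val-times yu≡))
    ℓ≡ : val (Vec.lookup env z) % betaModulus (val (Vec.lookup env u)) (val y) ≡ val (c ℓ)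
    ℓ≡ = remainder-unique (val b) (val (c ℓ))
      (subst (val (c ℓ) ≤_) w≡′ (≮⇒≥ (w≮ℓ ∘ from val-lt))) (begin
      val (Vec.lookup env z)                        ≡⟨ to val-plus z≡ ⟩
      val (c ℓ) + val e                             ≡⟨ cong (val (c ℓ) +_) (trans (to val-plus e≡)
                                                         (cong (val b +_) (to val-times bw≡))) ⟩
      val (c ℓ) + (val b + val b * val w)           ≡⟨ cong (val (c ℓ) +_) (*-suc (val b) (val w)) ⟨
      val (c ℓ) + val b * suc (val w)               ≡⟨ cong (λ W → val (c ℓ) + val b * suc W) w≡′ ⟩
      val (c ℓ) + val b * betaModulus (val (Vec.lookup env u)) (val y) ∎)

  -- All eight witnesses exist in the structure: quotients and their products are bounded by `x` or
  -- `z`, the first remainder by `p`, and `y * u` by `(y + 1) * u`, which is below `suc N` by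
  -- hypothesis.
  remainder-complete : ∀ {n} {env : Vec (Carrier A) n} {p u z x ℓ p′} →
    let val′ = λ i → val (Vec.lookup env i) in
    val′ p ≡ suc p′ → suc (val′ x % suc p′) * val′ u < suc N →
    val (c ℓ) ≡ val′ z % betaModulus (val′ u) (val′ x % suc p′) → env ⊨ remainder p u z x ℓ
  remainder-complete {env = env} {p} {u} {z} {x} {ℓ} {p′} p≡ w< ℓ≡
    with element {X / suc p′} (≤-<-trans (m/n≤m X (suc p′)) X<)
       | element {X / suc p′ * suc p′}
           (≤-<-trans (≤-trans (m≤n+m _ _) (≤-reflexive (sym (m≡m%n+[m/n]*n X (suc p′))))) X<)
       | element {X % suc p′} (<-trans (m%n<n X (suc p′)) (subst (_< suc N) p≡ (val< _)))
       | element {X % suc p′ * U} (≤-<-trans (m≤n+m _ U) w<)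
       | element w<
       | element {Z / suc W} (≤-<-trans (m/n≤m Z (suc W)) Z<)
       | element {Z / suc W * W} (≤-<-trans (≤-trans (*-monoʳ-≤ (Z / suc W) (n≤1+n W)) q*≤) Z<)
       | element {Z / suc W * suc W} (≤-<-trans q*≤ Z<)
    where
    X = val (Vec.lookup env x)
    U = val (Vec.lookup env u)
    Z = val (Vec.lookup env z)
    W = suc (X % suc p′) * U
    X< = val< (Vec.lookup env x)
    Z< = val< (Vec.lookup env z)
    q*≤ : Z / suc W * suc W ≤ Z
    q*≤ = ≤-trans (m≤n+m _ (Z % suc W)) (≤-reflexive (sym (m≡m%n+[m/n]*n Z (suc W))))
  ... | a , a≡ | ap , ap≡ | y , y≡ | yu , yu≡ | w , w≡ | b , b≡ | bw , bw≡ | e , e≡ =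
    a , ap , y ,
    from val-times (trans ap≡ (sym (cong₂ _*_ a≡ p≡))) ,
    from val-plus (trans (trans (m≡m%n+[m/n]*n X (suc p′)) (+-comm (X % suc p′) _)) (sym (cong₂ _+_ ap≡ y≡))) ,
    from val-lt (subst₂ _<_ (sym y≡) (sym p≡) (m%n<n X (suc p′))) ,
    yu , w ,
    from val-times (trans yu≡ (cong (_* U) (sym y≡))) ,
    from val-plus (trans w≡ (cong (U +_) (sym yu≡))) ,
    b , bw , e ,
    from val-times (trans bw≡ (sym (cong₂ _*_ b≡ w≡))) ,
    from val-plus (trans e≡ (trans (*-suc (Z / suc W) W) (sym (cong₂ _+_ b≡ bw≡)))) ,
    from val-plus (trans (m≡m%n+[m/n]*n Z (suc W)) (sym (cong₂ _+_ ℓ≡ e≡))) ,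
    λ w<ℓ → <⇒≱ (to val-lt w<ℓ) (subst₂ _≤_ (sym ℓ≡) (sym w≡) (s≤s⁻¹ (m%n<n Z (suc W))))
    where
    X = val (Vec.lookup env x)
    U = val (Vec.lookup env u)
    Z = val (Vec.lookup env z)
    W = suc (X % suc p′) * U

  ⋀-sat : ∀ {n} {env : Vec (Carrier A) n} φs → env ⊨ ⋀ φs ⇔ All (env ⊨_) φs
  ⋀-sat φs = mk⇔ (fwd φs) (bwd φs)
    where
    fwd : ∀ φs → _ ⊨ ⋀ φs → All (_ ⊨_) φs
    fwd [] _ = []
    fwd (φ ∷ φs) (s , ss) = s ∷ fwd φs ss
    bwd : ∀ φs → All (_ ⊨_) φs → _ ⊨ ⋀ φs
    bwd [] [] = refl
    bwd (φ ∷ φs) (s ∷ ss) = s , bwd φs ss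

  ⋁-sat : ∀ {n} {env : Vec (Carrier A) n} φs → env ⊨ ⋁ φs ⇔ Any (env ⊨_) φs
  ⋁-sat φs = mk⇔ (fwd φs) (bwd φs)
    where
    fwd : ∀ φs → _ ⊨ ⋁ φs → Any (_ ⊨_) φs
    fwd [] s = contradiction refl s
    fwd (φ ∷ φs) (inj₁ s) = here s
    fwd (φ ∷ φs) (inj₂ s) = there (fwd φs s)
    bwd : ∀ φs → Any (_ ⊨_) φs → _ ⊨ ⋁ φs
    bwd (φ ∷ φs) (here s) = inj₁ s
    bwd (φ ∷ φs) (there s) = inj₂ (bwd φs s)

  Bit : (P U Z x : Carrier A) → Fin m → Set
  Bit P U Z x ℓ = P ∷ U ∷ Z ∷ x ∷ [] ⊨ bit (# 0) (# 1) (# 2) (# 3) ℓ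

  abstract
    bit? : ∀ P U Z x ℓ → Dec (Bit P U Z x ℓ)
    bit? P U Z x ℓ = (P ∷ U ∷ Z ∷ x ∷ []) ⊨? bit (# 0) (# 1) (# 2) (# 3) ℓ

  code : (P U Z x : Carrier A) → Code
  code P U Z x = Vec.tabulate λ ℓ → does (bit? P U Z x ℓ)

  lookup-code : ∀ P U Z x ℓ → Vec.lookup (code P U Z x) ℓ ≡ does (bit? P U Z x ℓ)
  lookup-code P U Z x = Vec.lookup∘tabulate λ ℓ → does (bit? P U Z x ℓ)

  literal-sat : ∀ {n} {env : Vec (Carrier A) n} {φ} (d : Dec (env ⊨ φ)) b → env ⊨ literal b φ ⇔ does d ≡ b
  literal-sat (yes s) true  = mk⇔ (λ _ → refl) (λ _ → s)
  literal-sat (yes s) false = mk⇔ (contradiction s) (λ ())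
  literal-sat (no ¬s) true  = mk⇔ (λ s → contradiction s ¬s) (λ ())
  literal-sat (no ¬s) false = mk⇔ (λ _ → refl) (λ _ → ¬s)

  coded-sat : ∀ {n} {env : Vec (Carrier A) n} p u z x v → env ⊨ coded p u z x v ⇔
    code (Vec.lookup env p) (Vec.lookup env u) (Vec.lookup env z) (Vec.lookup env x) ≡ v
  coded-sat {env = env} p u z x v = mk⇔
    (λ s → trans
      (Vec.tabulate-cong λ ℓ → to (lit ℓ) (All.lookup (All.map⁻ (to (⋀-sat _) s)) (∈-allFin ℓ)))
      (Vec.tabulate∘lookup v))
    (λ { refl → from (⋀-sat _) (All.map⁺ (All.universal
      (λ ℓ → from (lit ℓ) (sym (lookup-code _ _ _ _ ℓ))) (allFin m))) })
    where
    lit : ∀ ℓ → env ⊨ literal (Vec.lookup v ℓ) (bit p u z x ℓ) ⇔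
      does (bit? (Vec.lookup env p) (Vec.lookup env u) (Vec.lookup env z) (Vec.lookup env x) ℓ) ≡ Vec.lookup v ℓ
    lit ℓ = literal-sat {env = env} {φ = bit p u z x ℓ} (bit? _ _ _ _ ℓ) (Vec.lookup v ℓ)

  code-≡⇒bit : ∀ {P U Z x y} ℓ → code P U Z x ≡ code P U Z y →
    Bit P U Z x ℓ → Bit P U Z y ℓ
  code-≡⇒bit {P} {U} {Z} {x} {y} ℓ eqn = does-≡⇒ (bit? P U Z x ℓ) (bit? P U Z y ℓ)
    (trans (sym (lookup-code P U Z x ℓ)) (trans (cong (λ v → Vec.lookup v ℓ) eqn) (lookup-code P U Z y ℓ)))

  module _ {P U Z : Carrier A} where

    codedTuple-sat : ∀ {n r} {env : Vec (Carrier A) n} {p u z} →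
      Vec.lookup env p ≡ P → Vec.lookup env u ≡ U → Vec.lookup env z ≡ Z →
      ∀ (xs : Vec (Fin n) r) s → env ⊨ codedTuple p u z xs s ⇔ Vec.map (code P U Z) (Vec.map (Vec.lookup env) xs) ≡ s
    codedTuple-sat refl refl refl [] [] = mk⇔ (λ _ → refl) (λ _ → refl)
    codedTuple-sat {env = env} {p} {u} {z} refl refl refl (x ∷ xs) (v ∷ s) = mk⇔
      (λ (a , b) → cong₂ _∷_ (to (coded-sat p u z x v) a) (to rest b))
      (λ eqn → from (coded-sat p u z x v) (Vec.∷-injectiveˡ eqn) , from rest (Vec.∷-injectiveʳ eqn))
      where rest = codedTuple-sat {env = env} {p} {u} {z} refl refl refl xs s

    realised-sat : ∀ {n r} {env : Vec (Carrier A) n} {p u z} →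
      Vec.lookup env p ≡ P → Vec.lookup env u ≡ U → Vec.lookup env z ≡ Z →
      ∀ (s : Vec Code r) → env ⊨ realised p u z s ⇔ (∃ λ t → Vec.map (code P U Z) t ≡ s)
    realised-sat refl refl refl [] = mk⇔ (λ _ → [] , refl) (λ _ → refl)
    realised-sat {env = env} {p} {u} {z} refl refl refl (v ∷ s) = mk⇔
      (λ ((a , e) , b) → let (t , eqn) = to rest b in
        a ∷ t , cong₂ _∷_ (to (coded-sat (suc p) (suc u) (suc z) zero v) e) eqn)
      (λ { (a ∷ t , eqn) →
        (a , from (coded-sat (suc p) (suc u) (suc z) zero v) (Vec.∷-injectiveˡ eqn)) ,
        from rest (t , Vec.∷-injectiveʳ eqn) })
      where rest = realised-sat {env = env} {p} {u} {z} refl refl refl s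

    private
      ps : Vec (Carrier A) 3
      ps = P ∷ U ∷ Z ∷ []

    translateTerm-eval : ∀ {n} {c₀ : Fin 0 → Carrier A} (env : Vec (Carrier A) n) t →
      evalT c (env Vec.++ ps) (translateTerm t) ≡ evalT c₀ env t
    translateTerm-eval env (var i) = Vec.lookup-++ˡ env ps i

    translateTerms-eval : ∀ {n k} {c₀ : Fin 0 → Carrier A} (env : Vec (Carrier A) n) (ts : Vec _ k) →
      Vec.map (evalT c (env Vec.++ ps)) (Vec.map translateTerm ts) ≡ Vec.map (evalT c₀ env) ts
    translateTerms-eval env ts = trans (sym (Vec.map-∘ _ _ ts)) (Vec.map-cong (translateTerm-eval env) ts)

    translate-sat : ∀ {r n} {c₀ : Fin 0 → Carrier A} (S : List (Vec Code r)) (env : Vec (Carrier A) n) φ →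
      Sat A c₀ (unary (λ t → Vec.map (code P U Z) t ∈ S)) env φ ⇔ env Vec.++ ps ⊨ translate S φ
    translate-sat {c₀ = c₀} S env (rel R ts) = mk⇔ (subst (T ∘ relI A R) (sym ts≡)) (subst (T ∘ relI A R) ts≡)
      where ts≡ = translateTerms-eval {c₀ = c₀} env ts
    translate-sat {c₀ = c₀} S env (eq s t) = mk⇔ (subst₂ _≡_ (sym s≡) (sym t≡)) (subst₂ _≡_ s≡ t≡)
      where
      s≡ = translateTerm-eval {c₀ = c₀} env s
      t≡ = translateTerm-eval {c₀ = c₀} env t
    translate-sat {n = n} {c₀ = c₀} S env (sov zero ts) = mk⇔
      (λ s → from (⋁-sat _) (Any.map⁺ (Any.map (λ eqn → from (tuple _) (trans codes≡ eqn)) s)))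
      (λ s → Any.map (λ s′ → trans (sym codes≡) (to (tuple _) s′)) (Any.map⁻ (to (⋁-sat _) s)))
      where
      xs = Vec.map (λ t → variable-of t ↑ˡ 3) ts
      tuple = codedTuple-sat {env = env Vec.++ ps} {n ↑ʳ # 0} {n ↑ʳ # 1} {n ↑ʳ # 2}
        (Vec.lookup-++ʳ env ps (# 0)) (Vec.lookup-++ʳ env ps (# 1)) (Vec.lookup-++ʳ env ps (# 2)) xs
      codes≡ : Vec.map (code P U Z) (Vec.map (Vec.lookup (env Vec.++ ps)) xs) ≡
        Vec.map (code P U Z) (Vec.map (evalT c₀ env) ts)
      codes≡ = cong (Vec.map (code P U Z)) (trans (sym (Vec.map-∘ _ _ ts)) (Vec.map-cong (translateTerm-eval env) ts))
    translate-sat S env (neg φ) = mk⇔ (_∘ from (translate-sat S env φ)) (_∘ to (translate-sat S env φ))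
    translate-sat S env (conj φ ψ) = mk⇔
      (Product.map (to (translate-sat S env φ)) (to (translate-sat S env ψ)))
      (Product.map (from (translate-sat S env φ)) (from (translate-sat S env ψ)))
    translate-sat S env (disj φ ψ) = mk⇔
      (Sum.map (to (translate-sat S env φ)) (to (translate-sat S env ψ)))
      (Sum.map (from (translate-sat S env φ)) (from (translate-sat S env ψ)))
    translate-sat S env (exi φ) = mk⇔
      (Product.map₂ (to (translate-sat S _ φ))) (Product.map₂ (from (translate-sat S _ φ)))
    translate-sat S env (all φ) = mk⇔
      (λ s a → to (translate-sat S (a ∷ env) φ) (s a)) (λ s a → from (translate-sat S (a ∷ env) φ) (s a))

  separating-bits : ∀ {P U Z xs} →
    (∀ {x} → x ∈ xs → ∃ λ ℓ → Bit P U Z x ℓ × (∀ {y} → y ∈ xs → Bit P U Z y ℓ → x ≡ y)) →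
    InjectiveOn (code P U Z) xs
  separating-bits sep {x} {y} x∈ y∈ eqn with sep x∈
  ... | ℓ , b , unique = unique y∈ (code-≡⇒bit {x = x} {y} ℓ eqn b)

  val-0 : val (c zero) ≡ 0
  val-0 = cong toℕ (index-ι zero)

  -- Here constants name all elements. With `p = 0` the bit `ℓ` holds exactly for the element named
  -- by `ℓ`.
  separating-small : suc N ≤ m → ∀ xs → InjectiveOn (code (c zero) (c zero) (c zero)) xs
  separating-small N<m xs = separating-bits λ {x} _ → named x ,
    inj₁ (refl , x≡ x) , λ
      { {y} _ (inj₁ (_ , y≡)) → trans (x≡ x) (sym y≡)
      ; {y} _ (inj₂ s) →
          let (_ , 0≡suc , _) = remainder-sound {env = c zero ∷ c zero ∷ c zero ∷ y ∷ []} {# 0} {# 1} {# 2} {# 3} s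
          in contradiction (trans (sym val-0) 0≡suc) λ () }
    where
    named : Carrier A → Fin m
    named x = fromℕ< (≤-trans (val< x) N<m)
    toℕ-named : ∀ x → toℕ (named x) ≡ val x
    toℕ-named x = Fin.toℕ-fromℕ< _
    x≡ : ∀ x → x ≡ c (named x)
    x≡ x = val-injective (sym (trans
      (val-const (named x) (subst (_≤ N) (sym (toℕ-named x)) (s≤s⁻¹ (val< x)))) (toℕ-named x)))

  -- The bit that singles out `x` is its residue: `g ≤ m` provides a constant for it, `m ≤ N`
  -- ensures that this constant is not clamped, and `P` being nonzero disables the first disjunct of
  -- `bit`.
  separating-large : ∀ {g} xs → g ≤ m → m ≤ N → Separation g (suc N) (map val xs) →
    ∃ λ P → ∃ λ U → ∃ λ Z → InjectiveOn (code P U Z) xs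
  separating-large {g} xs g≤m m≤N (p , u , z , p< , u< , z< , w< , residue< , residue-injective)
    with element p< | element u< | element z<
  ... | P , P≡ | U , refl | Z , refl = P , U , Z , separating-bits λ {x} x∈ →
    named x∈ ,
    inj₂ (remainder-complete {env = P ∷ U ∷ Z ∷ x ∷ []} {# 0} {# 1} {# 2} {# 3} P≡ (w< (val x)) (val-named x∈)) ,
    λ { {y} _ (inj₁ (P≡0 , _)) → contradiction (trans (sym P≡) (trans (cong val P≡0) val-0)) (λ ())
      ; {y} y∈ (inj₂ s) → collapse x∈ y∈ (remainder-sound {env = P ∷ U ∷ Z ∷ y ∷ []} {# 0} {# 1} {# 2} {# 3} s) }
    where
    residueℕ : Carrier A → ℕ
    residueℕ x = val Z % betaModulus (val U) (val x % suc p)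
    named : ∀ {x} → x ∈ xs → Fin m
    named x∈ = fromℕ< (≤-trans (residue< (∈-map⁺ val x∈)) g≤m)
    val-named : ∀ {x} (x∈ : x ∈ xs) → val (c (named x∈)) ≡ residueℕ x
    val-named x∈ = trans
      (val-const (named x∈) (≤-trans (<⇒≤ (Fin.toℕ<n (named x∈))) m≤N)) (Fin.toℕ-fromℕ< _)
    collapse : ∀ {x y} (x∈ : x ∈ xs) → y ∈ xs →
      (∃ λ p′ → val P ≡ suc p′ × val (c (named x∈)) ≡ val Z % betaModulus (val U) (val y % suc p′)) → x ≡ y
    collapse x∈ y∈ (p′ , P≡′ , r≡) with suc-injective (trans (sym P≡) P≡′)
    ... | refl = val-injective (residue-injective (∈-map⁺ val x∈) (∈-map⁺ val y∈) (trans (sym (val-named x∈)) r≡))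

  separating : ∀ {g} → proj₁ (separationThreshold g) + g ≤ m → ∀ xs → length xs ≤ g →
    ∃ λ P → ∃ λ U → ∃ λ Z → InjectiveOn (code P U Z) xs
  separating {g} ≤m xs len with suc N ≤? m
  ... | yes N<m = c zero , c zero , c zero , separating-small N<m xs
  ... | no  N≮m = separating-large xs (≤-trans (m≤n+m g _) ≤m) m≤N
    (proj₂ (separationThreshold g) (suc N) (≤-trans (≤-trans (m≤m+n _ g) ≤m) (m≤n⇒m≤1+n m≤N))
      (map val xs) (All.map⁺ (All.universal val< xs)) (≤-trans (≤-reflexive (length-map val xs)) len))
    where
    m≤N : m ≤ N
    m≤N = s≤s⁻¹ (≰⇒> N≮m)

-- The slice sentences

allVecs : ∀ {B : Set} → List B → ∀ n → List (Vec B n)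
allVecs bs zero    = [] ∷ []
allVecs bs (suc n) = cartesianProductWith _∷_ bs (allVecs bs n)

∈-allVecs : ∀ {B : Set} {bs : List B} → (∀ b → b ∈ bs) → ∀ {n} (v : Vec B n) → v ∈ allVecs bs n
∈-allVecs every []      = here refl
∈-allVecs every (b ∷ v) = ∈-cartesianProductWith⁺ _∷_ (every b) (∈-allVecs every v)

allLists : ∀ {B : Set} → List B → ℕ → List (List B)
allLists bs n = map Vec.toList (allVecs bs n)

∈-allLists : ∀ {B : Set} {bs : List B} → (∀ b → b ∈ bs) → ∀ {n} xs → length xs ≡ n → xs ∈ allLists bs n
∈-allLists {bs = bs} every xs refl = subst (_∈ allLists bs (length xs)) (Vec.toList∘fromList xs)
  (∈-map⁺ Vec.toList (∈-allVecs every (Vec.fromList xs)))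

length-allLists : ∀ {B : Set} (bs : List B) {n xs} → xs ∈ allLists bs n → length xs ≡ n
length-allLists bs xs∈ with ∈-map⁻ Vec.toList xs∈
... | v , _ , refl = Vec.length-toList v

entries : ∀ {B : Set} {r} → List (Vec B r) → List B
entries = concatMap Vec.toList

length-entries : ∀ {B : Set} {r} (ts : List (Vec B r)) → length (entries ts) ≡ length ts * r
length-entries [] = refl
length-entries (t ∷ ts) = trans (length-++ (Vec.toList t)) (cong₂ _+_ (Vec.length-toList t) (length-entries ts))

InjectiveOn-map : ∀ {B C : Set} {f : B → C} {r} {ts : List (Vec B r)} →
  InjectiveOn f (entries ts) → InjectiveOn (Vec.map f) ts
InjectiveOn-map {B} {f = f} {ts = ts} inj {t} {t′} t∈ t′∈ =
  go t t′ (λ x∈ → ∈-concat⁺′ x∈ (∈-map⁺ Vec.toList t∈))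
    (λ x∈ → ∈-concat⁺′ x∈ (∈-map⁺ Vec.toList t′∈))
  where
  go : ∀ {r} (t t′ : Vec B r) → Vec.toList t ⊆ entries ts → Vec.toList t′ ⊆ entries ts →
    Vec.map f t ≡ Vec.map f t′ → t ≡ t′
  go [] [] _ _ _ = refl
  go (x ∷ t) (x′ ∷ t′) sub sub′ eqn = cong₂ _∷_
    (inj (sub (here refl)) (sub′ (here refl)) (Vec.∷-injectiveˡ eqn))
    (go t t′ (sub ∘ there) (sub′ ∘ there) (Vec.∷-injectiveʳ eqn))

Unique-map : ∀ {B C : Set} {f : B → C} {xs} → InjectiveOn f xs → Unique xs → Unique (map f xs)
Unique-map inj xs! = AllPairs.map⁺ (AllPairs-tabulate xs! λ x∈ y∈ x≢y eqn → x≢y (inj x∈ y∈ eqn))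

preimages : ∀ {B C : Set} (f : B → C) {ys} → All (λ y → ∃ λ x → f x ≡ y) ys → ∃ λ xs → map f xs ≡ ys
preimages f [] = [] , refl
preimages f ((x , refl) ∷ rest) = let (xs , eqn) = preimages f rest in x ∷ xs , cong (f x ∷_) eqn

module Slice {τ : Vocab} {r : ℕ} (φ : Formula τ (r ∷ []) 0 0) (k : ℕ) where

  -- The hash must separate the `r` entries of each tuple in a refuting list, or of each of the `k`
  -- tuples of a solution; the sum covers both uses.
  capacity : ℕ
  capacity = (treeSize (clauseWidth φ) k + k) * r

  bits : ℕ
  -- The first summand puts every structure with more than `m` elements above the threshold; the
  -- second leaves a constant for each residue below `capacity`.
  bits = proj₁ (separationThreshold capacity) + capacity

  open Formulas {τ} {bits} public

  codeSets : List (List (Vec Code r))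
  codeSets = allLists (allVecs (allVecs (true ∷ false ∷ []) m) r) k

  ∈-codeSets : ∀ S → length S ≡ k → S ∈ codeSets
  ∈-codeSets = ∈-allLists (∈-allVecs (∈-allVecs λ { true → here refl ; false → there (here refl) }))

  open UniqueDec (Vec.≡-dec {n = r} (Vec.≡-dec {n = m} Bool._≟_)) using (unique?)

  enoughTuples : Formula τ [] m 3
  enoughTuples = ⋁ (map (λ S → ⋀ (map (realised (# 0) (# 1) (# 2)) S)) (filter unique? codeSets))

  hitting : Formula τ [] m 3
  hitting = ⋁ (map (λ S → translate S φ) codeSets)

  -- The parameters of `hitting` are quantified universally: a solution provides codes for every
  -- hash, whereas one hash injective on a refuting list is enough for falsity. For `enoughTuples`
  -- any one hash with `k` distinct values is a witness.
  slice : Sentence τ m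
  slice = conj (exi (exi (exi enoughTuples))) (all (all (all hitting)))

  qr-enoughTuples : qr enoughTuples ≤ 9
  qr-enoughTuples = qr-⋁ (map _ (filter unique? codeSets)) (All.map⁺ (All.universal
    (λ S → qr-⋀ (map _ S) (All.map⁺ (All.universal (qr-realised (# 0) (# 1) (# 2)) S))) _))

  qr-hitting : qr hitting ≤ 9 + qr φ
  qr-hitting = qr-⋁ (map _ codeSets) (All.map⁺ (All.universal (λ S → ≤-trans (qr-translate S φ)
    (≤-trans (≤-reflexive (+-comm (qr φ) 8)) (n≤1+n _))) codeSets))

  -- Three parameters, one coordinate in `realised` and the eight quantifiers of `remainder` account
  -- for 12; the bound is independent of `k`.
  qr-slice : qr slice ≤ 12 + qr φ
  qr-slice = ⊔-lub (+-monoʳ-≤ 3 (≤-trans qr-enoughTuples (m≤m+n 9 (qr φ)))) (+-monoʳ-≤ 3 qr-hitting)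

  module _ (pos : SONotUnderExNeg φ) (A : Structure τ) (w : ArithIso A) (c₀ : Fin 0 → Carrier A)
    (None : (i : Fin 0) → Vec (Carrier A) (List.lookup [] i) → Set) where
    open Semantics A w bits None
    open Arithmetic A w using (_≟ᶜ_)
    open SearchTree A w {r} c₀

    separated : ∀ (W : List Tuple) → length W ≤ treeSize (clauseWidth φ) k + k →
      ∃ λ P → ∃ λ U → ∃ λ Z → InjectiveOn (Vec.map (code P U Z)) W
    separated W len = let (P , U , Z , inj) = separating {capacity} (n≤1+n bits) (entries W)
                            (≤-trans (≤-reflexive (length-entries W)) (*-monoˡ-≤ r len))
                      in P , U , Z , InjectiveOn-map inj

    Solved : Set
    Solved = ∃ λ S → Unique S × length S ≡ k × [] ⊨[ _∈ S ] φ

    slice-complete : Solved → [] ⊨ slice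
    slice-complete (S , S! , len , s) with separated S (≤-trans (≤-reflexive len) (m≤n+m k _))
    ... | P , U , Z , inj =
      -- The outermost quantifier binds the last entry of the environment `P ∷ U ∷ Z ∷ []`, so the
      -- witnesses appear in reverse order.
      (Z , U , P , from (⋁-sat _) (Any.map⁺ (lose
        (∈-filter⁺ unique? (∈-codeSets _ (trans (length-map _ S) len)) (Unique-map inj S!))
        (from (⋀-sat _) (All.map⁺ (All.map⁺ (All.universal
          (λ t → from (realised-sat refl refl refl _) (t , refl)) S))))))) ,
      λ Z U P → from (⋁-sat _) (Any.map⁺ (lose
        (∈-codeSets (map (Vec.map (code P U Z)) S) (trans (length-map _ S) len))
        (to (translate-sat _ [] φ) (⊨-mono φ pos (∈-map⁺ _) s))))

    enoughTuples-sound : ∀ {P U Z} → P ∷ U ∷ Z ∷ [] ⊨ enoughTuples →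
      ∃ λ (S : List Tuple) → Unique S × length S ≡ k
    enoughTuples-sound {P} {U} {Z} s with find (Any.map⁻ (to (⋁-sat _) s))
    ... | C , C∈ , real
      with ∈-filter⁻ unique? {xs = codeSets} C∈
         | preimages (Vec.map (code P U Z)) {C} (All.map
             (λ {v} → to (realised-sat {env = P ∷ U ∷ Z ∷ []} {# 0} {# 1} {# 2} refl refl refl v))
             (All.map⁻ (to (⋀-sat _) real)))
    ... | C∈sets , C! | S , refl = S , Unique.map⁻ C! , trans (sym (length-map _ S)) (length-allLists _ C∈sets)

    -- The search may return a short list or one with repetitions. By monotonicity of `φ` it can be
    -- deduplicated and then enlarged to exactly `k` tuples.
    pad : ∀ {S T : List Tuple} → Unique T → length S ≤ length T →
      ∃ λ S′ → S ⊆ S′ × Unique S′ × length S′ ≡ length T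
    pad {S} {T} T! len =
      let (S′ , sub , S′! , len′) = Unique-extend _≟ᵗ_ T! (length T ∸ length D) {D}
            (deduplicate-! S) (m∸n+n≡m (≤-trans (length-deduplicate _≟ᵗ_ S) len))
      in S′ , sub ∘ ∈-deduplicate⁺ _≟ᵗ_ , S′! , len′
      where
      _≟ᵗ_ = Vec.≡-dec {n = r} _≟ᶜ_
      open UniqueDecP _≟ᵗ_ using (deduplicate-!)
      D = deduplicate _≟ᵗ_ S

    slice-sound : [] ⊨ slice → Solved
    slice-sound ((Z , U , P , enough) , hit)
      with solution-or-refutation (Vec Code r) [] φ pos k []
    ... | inj₁ (S , len , s) =
      let (T , T! , lenT) = enoughTuples-sound enough
          (S′ , sub , S′! , len′) = pad {S} {T} T! (≤-trans len (≤-reflexive (sym lenT)))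
      in S′ , S′! , trans len′ lenT , ⊨-mono φ pos (λ t∈ → sub (subst (_ ∈_) (++-identityʳ S) t∈)) s
    ... | inj₂ (W , len , refutes)
      with separated W (≤-trans len (m≤m+n _ k))
    ... | P′ , U′ , Z′ , inj
      with find (Any.map⁻ (to (⋁-sat _) (hit Z′ U′ P′)))
    ... | S , S∈ , s = contradiction (from (translate-sat S [] φ) s)
      (refutes (Vec.map (code P′ U′ Z′)) (subst (InjectiveOn _) (sym (++-identityʳ W)) inj)
        S (≤-reflexive (length-allLists _ S∈)))

theorem4p1 : (τ : Vocab) (r : ℕ) (φ : Formula τ (r ∷ []) 0 0) →
    SONotUnderExNeg φ →
    ∃ λ q → SlicewiseFO τ q (λ A w k → FD φ A k)
theorem4p1 τ r φ pos = 12 + qr φ , _ , Slice.slice φ , Slice.qr-slice φ , λ A w k → mk⇔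
  (λ (S , S! , len , s) → Slice.slice-complete φ k pos A w (λ ()) _
    (S , S! , len , Sat-consts A φ (λ ()) (Sat-mono A φ pos (λ { zero _ t∈ → t∈ }) s)))
  (λ s → let (S , S! , len , s′) = Slice.slice-sound φ k pos A w (λ ()) _ s
         in S , S! , len , Sat-mono A φ pos (λ { zero _ t∈ → t∈ }) (Sat-consts A φ (λ ()) s′))
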